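{- Let $G$ be a finite simple graph with no isolated vertices that is claw-free, i.e. $G$ contains no induced subgraph isomorphic to $K_{1,3}$. Then \[ f_o(G)\ge \frac{|V(G)|}{\chi(G)}, \] where $\chi(G)$ is the chromatic number of $G$.
   Context: All graphs are finite and simple. An induced subgraph $H$ of $G$ is called odd if every vertex of $H$ has odd degree in $H$. $f_o(G)$ denotes the maximum number of vertices of an odd induced subgraph of $G$. -}

module Defs where

open import Data.Nat using (ℕ; _≤_; _<_; _%_)
open import Data.Bool using (Bool; true; false)
open import Data.Fin using (Fin)
open import Data.Fin.Subset using (Subset; _∈_; _∩_; ∣_∣)
open import Data.Vec using (tabulate)
open import Data.Product using (Σ; ∃; _×_; _,_)
open import Relation.Binary.PropositionalEquality using (_≡_; _≢_)
open import Relation.Nullary using (¬_)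

record Graph (n : ℕ) : Set where
  field
    adj   : Fin n → Fin n → Bool
    sym   : ∀ u v → adj u v ≡ adj v u
    irref : ∀ v → adj v v ≡ false

open Graph public

Adj : ∀ {n} → Graph n → Fin n → Fin n → Set
Adj G u v = adj G u v ≡ true

N : ∀ {n} → Graph n → Fin n → Subset n
N G v = tabulate (adj G v)

degIn : ∀ {n} → Graph n → Subset n → Fin n → ℕ
degIn G S v = ∣ S ∩ N G v ∣

IsOddInduced : ∀ {n} → Graph n → Subset n → Set
IsOddInduced G S = ∀ v → v ∈ S → degIn G S v % 2 ≡ 1

IsFo : ∀ {n} → Graph n → ℕ → Set
IsFo G m = (Σ _ λ S → IsOddInduced G S × ∣ S ∣ ≡ m)
         × (∀ S → IsOddInduced G S → ∣ S ∣ ≤ m)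

ProperColouring : ∀ {n} → Graph n → (k : ℕ) → (Fin n → Fin k) → Set
ProperColouring G k c = ∀ u v → Adj G u v → c u ≢ c v

Colourable : ∀ {n} → Graph n → ℕ → Set
Colourable G k = Σ _ λ c → ProperColouring G k c

IsChromaticNumber : ∀ {n} → Graph n → ℕ → Set
IsChromaticNumber G k = Colourable G k × (∀ j → j < k → ¬ Colourable G j)

NoIsolatedVertices : ∀ {n} → Graph n → Set
NoIsolatedVertices G = ∀ v → ∃ λ u → Adj G v u

ClawFree : ∀ {n} → Graph n → Set
ClawFree G = ∀ c a b d → Adj G c a → Adj G c b → Adj G c d
           → a ≢ b → a ≢ d → b ≢ d
           → ¬ (adj G a b ≡ false × adj G a d ≡ false × adj G b d ≡ false)

{-# OPTIONS --safe #-}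
module Submission where

-- Proof.  Odd induced subgraphs of different components may be united, so let G be connected,
-- let α be its independence number and m = ⌊α/2⌋.
--
-- (1) f_o(G) ≥ 2m.  Grow a vertex set U around a maximum independent set I so that G[U] stays
-- the line graph of a tree H; each vertex of I after the first costs at least one connecting
-- vertex, hence H has at least 2α nodes and a side A of its bipartition contains at least α ≥ 2m
-- of them.  If |A| is even, H has a set F of edges with odd degree exactly at the nodes of A.
-- Every edge of F joins a node of odd degree to one of even degree, so F induces an odd subgraph
-- of G, and |F| ≥ |A|.  The subtrees met while H grows contain one with exactly 2m nodes in A.
--
-- (2) If n > 2mk, then α = 2m + 1 and there are colour classes I, J with |I| = α and |J| ≥ α − 1.
-- By claw-freeness G[I ∪ J] has maximum degree 2, so if it has no isolated vertex, it has an
-- induced matching covering at least half of its vertices, i.e. at least α.  The maximality of α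
-- leaves room for one isolated vertex v only; then v is matched to a neighbour x outside I ∪ J,
-- which costs at most four vertices of I ∪ J unless x lies in an induced net, itself odd.

open import Defs hiding (sym)
open import Data.Bool using (Bool; true; false; T; _∧_; _∨_; _xor_; not)
open import Data.Bool.Properties using (xor-assoc; xor-comm; ∧-comm; not-involutive)
import Data.Bool.Properties as Boolₚ
open import Data.Empty using (⊥; ⊥-elim)
open import Data.Fin using (Fin; zero; suc)
open import Data.Fin.Properties using (_≟_; any?; all?)
import Data.Fin.Subset as Sub
open import Data.Fin.Subset.Properties using (anySubset?)
open import Data.List using (List; []; _∷_; length; map; _++_)
open import Data.List.Membership.Propositional using (_∈_; _∉_)
open import Data.List.Membership.Propositional.Properties using (∈-map⁺; ∈-map⁻; ∈-++⁻)
open import Data.List.Properties using (length-map; length-++)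
open import Data.List.Relation.Unary.All using ([]; _∷_)
import Data.List.Relation.Unary.All as All
open import Data.List.Relation.Unary.AllPairs using ([]; _∷_)
open import Data.List.Relation.Unary.Any using (here; there)
open import Data.List.Relation.Unary.Unique.Propositional using (Unique)
open import Data.List.Relation.Unary.Unique.Propositional.Properties using (++⁺)
open import Data.Nat using (ℕ; zero; suc; _+_; _*_; _≤_; _<_; z≤n; s≤s; _%_; _≡ᵇ_; _≤?_; _<?_)
open import Data.Nat.Properties using (≤-refl; ≤-trans; ≤-reflexive; ≤-pred; <-irrefl; <-asym; <-trans; <⇒≢; n≤1+n; m≤n+m; m≤n⇒m≤1+n; m≤n⇒m<n∨m≡n; +-mono-≤; +-monoʳ-≤; +-suc; +-identityʳ; ≡ᵇ⇒≡)
import Data.Nat.Properties as ℕₚ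
open import Data.Nat.Tactic.RingSolver using (solve-∀)
open import Data.Product using (∃; ∃₂; _×_; _,_; proj₁; proj₂)
open import Data.Sum using (_⊎_; inj₁; inj₂; [_,_]′)
open import Data.Unit using (⊤; tt)
open import Data.Vec using (tabulate; lookup)
open import Data.Vec.Properties using ([]=⇒lookup; lookup∘tabulate)
open import Function using (_∘_)
open import Relation.Binary.PropositionalEquality using (_≡_; _≢_; refl; sym; trans; cong; cong₂; subst; ≢-sym)
open import Relation.Nullary using (¬_; Dec; yes; no; does; ¬?)
open import Relation.Nullary.Decidable using (_×-dec_; _→-dec_; map′)

-- The set F is a T-join of the tree for T = A. It has at least |A| edges because each node of A
-- needs an edge and no edge has two ends in A. A T-join exists only when |T| is even, which is why
-- (1) loses one vertex for odd α and (2) has to recover it. To extend H, a new vertex that meets U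
-- and also has a neighbour away from U must be adjacent to exactly the edges at one node.
-- Claw-freeness leaves one obstruction: two leaf edges at a common node, both adjacent to the new
-- vertex, beside a third edge there that is not. The invariant that every leaf edge of H belongs to
-- the independent set I excludes it. In (2), |J| ≥ α - 1 because at least two colours occur: one
-- class of size at most 2m + 1 and all others of size at most 2m - 1 give a total of at most 2mk.
-- The accounting then allows two vertices of I ∪ J to be deleted for each vertex put into the odd
-- subgraph; since |I ∪ J| ≥ 4m + 1, this yields more than 2m vertices. An edge may thus delete four
-- vertices, and a net, with six vertices, deletes only five.

-- Boolean reasoning and parity

true≢false : {A : Set} {b : Bool} → b ≡ true → b ≡ false → A
true≢false refl ()

∧-elim : ∀ {a b} → a ∧ b ≡ true → a ≡ true × b ≡ true
∧-elim {true} {true} _ = refl , refl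

∧-intro : ∀ {a b} → a ≡ true → b ≡ true → a ∧ b ≡ true
∧-intro refl refl = refl

∨-elim : ∀ {a b} → a ∨ b ≡ true → a ≡ true ⊎ b ≡ true
∨-elim {true} _ = inj₁ refl
∨-elim {false} p = inj₂ p

∨-introʳ : ∀ {a b} → b ≡ true → a ∨ b ≡ true
∨-introʳ {true} _ = refl
∨-introʳ {false} p = p

∨-introˡ : ∀ {a b} → a ≡ true → a ∨ b ≡ true
∨-introˡ refl = refl

not-elim : ∀ {a} → not a ≡ true → a ≡ false
not-elim {false} _ = refl

not-intro : ∀ {a} → a ≡ false → not a ≡ true
not-intro refl = refl

by-cases : ∀ b → b ≡ true ⊎ b ≡ false
by-cases true = inj₁ refl
by-cases false = inj₂ refl

¬true⇒false : ∀ {b} → ¬ b ≡ true → b ≡ false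
¬true⇒false {true} p = ⊥-elim (p refl)
¬true⇒false {false} p = refl

odd : ℕ → Bool
odd zero = false
odd (suc k) = not (odd k)

odd⇒%2 : ∀ k → odd k ≡ true → k % 2 ≡ 1
odd⇒%2 (suc zero) _ = refl
odd⇒%2 (suc (suc k)) p = odd⇒%2 k (trans (sym (not-involutive (odd k))) p)

-- Finite sets of vertices

VSet : ℕ → Set
VSet n = Fin n → Bool

𝟙 : Bool → ℕ
𝟙 true = 1
𝟙 false = 0

# : ∀ {n} → VSet n → ℕ
# {zero} f = 0
# {suc n} f = 𝟙 (f zero) + # (f ∘ suc)

infix 4 _⊆_
_⊆_ : ∀ {n} → VSet n → VSet n → Set
f ⊆ g = ∀ v → f v ≡ true → g v ≡ true

𝟙-mono : ∀ {a b} → (a ≡ true → b ≡ true) → 𝟙 a ≤ 𝟙 b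
𝟙-mono {true} p rewrite p refl = ≤-refl
𝟙-mono {false} p = z≤n

#-mono : ∀ {n} {f g : VSet n} → f ⊆ g → # f ≤ # g
#-mono {zero} p = z≤n
#-mono {suc n} p = +-mono-≤ (𝟙-mono (p zero)) (#-mono (λ v → p (suc v)))

#-cong : ∀ {n} {f g : VSet n} → (∀ v → f v ≡ g v) → # f ≡ # g
#-cong {zero} p = refl
#-cong {suc n} p = cong₂ _+_ (cong 𝟙 (p zero)) (#-cong (λ v → p (suc v)))

+-interchange : ∀ a b c d → (a + b) + (c + d) ≡ (a + c) + (b + d)
+-interchange = solve-∀

#-pointwise-≤ : ∀ {n} {f g h : VSet n} → (∀ v → 𝟙 (f v) + 𝟙 (g v) ≤ 𝟙 (h v)) → # f + # g ≤ # h
#-pointwise-≤ {zero} p = z≤n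
#-pointwise-≤ {suc n} {f} {g} {h} p =
  ≤-trans (≤-reflexive (+-interchange (𝟙 (f zero)) (# (f ∘ suc)) (𝟙 (g zero)) (# (g ∘ suc))))
          (+-mono-≤ (p zero) (#-pointwise-≤ (λ v → p (suc v))))

#-disjoint : ∀ {n} {f g h : VSet n} → f ⊆ h → g ⊆ h → (∀ v → f v ≡ true → g v ≡ true → ⊥) → # f + # g ≤ # h
#-disjoint {f = f} {g} {h} f⊆h g⊆h dis = #-pointwise-≤ pointwise
  where
  pointwise : ∀ v → 𝟙 (f v) + 𝟙 (g v) ≤ 𝟙 (h v)
  pointwise v with f v in fv | g v in gv
  ... | true  | true  = ⊥-elim (dis v fv gv)
  ... | true  | false rewrite f⊆h v fv = ≤-refl
  ... | false | true  rewrite g⊆h v gv = ≤-refl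
  ... | false | false = z≤n

#-split : ∀ {n} (f g : VSet n) → # f ≤ # (λ v → f v ∧ g v) + # (λ v → f v ∧ not (g v))
#-split {zero} f g = z≤n
#-split {suc n} f g with f zero | g zero | #-split (f ∘ suc) (g ∘ suc)
... | true  | true  | ih = s≤s ih
... | true  | false | ih = ≤-trans (s≤s ih) (≤-reflexive (sym (+-suc _ _)))
... | false | _     | ih = ih

#-witness : ∀ {n} (f : VSet n) → (∃ λ v → f v ≡ true) ⊎ # f ≡ 0
#-witness {zero} f = inj₂ refl
#-witness {suc n} f with f zero in eq | #-witness (f ∘ suc)
... | true  | _             = inj₁ (zero , eq)
... | false | inj₁ (v , p)  = inj₁ (suc v , p)
... | false | inj₂ p        = inj₂ p

#-zero : ∀ {n} {f : VSet n} → (∀ v → f v ≡ false) → # f ≡ 0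
#-zero {zero} p = refl
#-zero {suc n} {f} p rewrite p zero = #-zero (λ v → p (suc v))

#-pos : ∀ {n} {f : VSet n} {v} → f v ≡ true → 0 < # f
#-pos {f = f} {zero} p rewrite p = s≤s z≤n
#-pos {f = f} {suc v} p = ≤-trans (#-pos {f = f ∘ suc} p) (m≤n+m _ (𝟙 (f zero)))

infix 4 _==_
_==_ : ∀ {n} → Fin n → Fin n → Bool
u == v = does (u ≟ v)

==-refl : ∀ {n} (v : Fin n) → (v == v) ≡ true
==-refl v with v ≟ v
... | yes _ = refl
... | no ne = ⊥-elim (ne refl)

==-sound : ∀ {n} {u v : Fin n} → (u == v) ≡ true → u ≡ v
==-sound {u = u} {v} p with u ≟ v
... | yes e = e

==-false : ∀ {n} {u v : Fin n} → u ≢ v → (u == v) ≡ false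
==-false {u = u} {v} ne with u ≟ v
... | yes e = ⊥-elim (ne e)
... | no _ = refl

#-insert : ∀ {n} {f g : VSet n} v → f v ≡ false → g v ≡ true → (∀ u → u ≢ v → f u ≡ g u) → # g ≡ suc (# f)
#-insert zero fv gv p rewrite fv | gv = cong suc (sym (#-cong (λ u → p (suc u) (λ ()))))
#-insert {f = f} {g} (suc v) fv gv p rewrite p zero (λ ()) =
  trans (cong (𝟙 (g zero) +_) (#-insert v fv gv (λ u ne → p (suc u) (λ { refl → ne refl })))) (+-suc _ _)

elem : ∀ {n} → Fin n → List (Fin n) → Bool
elem u [] = false
elem u (v ∷ xs) = (u == v) ∨ elem u xs

elem-sound : ∀ {n} {u : Fin n} xs → elem u xs ≡ true → u ∈ xs
elem-sound (v ∷ xs) p with ∨-elim p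
... | inj₁ q = here (==-sound q)
... | inj₂ q = there (elem-sound xs q)

elem-complete : ∀ {n} {u : Fin n} {xs} → u ∈ xs → elem u xs ≡ true
elem-complete {u = u} (here refl) = ∨-introˡ (==-refl u)
elem-complete {xs = v ∷ xs} (there p) = ∨-introʳ (elem-complete p)

elem-false : ∀ {n} {u : Fin n} xs → u ∉ xs → elem u xs ≡ false
elem-false xs ne = ¬true⇒false (ne ∘ elem-sound xs)

infixl 5 _∖_
_∖_ : ∀ {n} → VSet n → List (Fin n) → VSet n
(f ∖ xs) u = f u ∧ not (elem u xs)

∖-∈ : ∀ {n} (f : VSet n) xs {u} → (f ∖ xs) u ≡ true → f u ≡ true × u ∉ xs
∖-∈ f xs p with ∧-elim p
... | a , b = a , λ m → true≢false (elem-complete m) (not-elim b)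

∖-intro : ∀ {n} (f : VSet n) xs {u} → f u ≡ true → u ∉ xs → (f ∖ xs) u ≡ true
∖-intro f xs p ne = ∧-intro p (not-intro (elem-false xs ne))

-- Only a bound, since `xs` may repeat vertices or list some outside `f`. This permits deletion
-- lists of fixed length that are padded by repetitions.
#-∖ : ∀ {n} (f : VSet n) xs → # f ≤ length xs + # (f ∖ xs)
#-∖ {n} f [] = #-mono {f = f} {f ∖ []} (λ v p → ∧-intro p refl)
#-∖ f (x ∷ xs) with by-cases ((f ∖ xs) x)
... | inj₁ fx = ≤-trans (#-∖ f xs) (≤-trans (+-monoʳ-≤ (length xs) (≤-reflexive (#-insert {f = f ∖ (x ∷ xs)} x gone fx same)))
                        (≤-reflexive (+-suc _ _)))
  where
  gone : (f ∖ (x ∷ xs)) x ≡ false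
  gone = ¬true⇒false (λ p → proj₂ (∖-∈ f (x ∷ xs) p) (here refl))
  same : ∀ u → u ≢ x → (f ∖ (x ∷ xs)) u ≡ (f ∖ xs) u
  same u ne rewrite ==-false ne = refl
... | inj₂ fx = ≤-trans (#-∖ f xs) (≤-trans (+-monoʳ-≤ (length xs) (#-mono sub)) (n≤1+n _))
  where
  sub : (f ∖ xs) ⊆ (f ∖ (x ∷ xs))
  sub u p with ∖-∈ f xs p
  ... | a , ne = ∖-intro f (x ∷ xs) a λ { (here refl) → true≢false p fx ; (there q) → ne q }

-- Odd lists of vertices

Unique-∷ : ∀ {n} {v : Fin n} {S} → v ∉ S → Unique S → Unique (v ∷ S)
Unique-∷ ne U = All.tabulate (λ { m refl → ne m }) ∷ U

Unique-∉ : ∀ {n} {v : Fin n} {S} → Unique (v ∷ S) → v ∉ S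
Unique-∉ (a ∷ _) m = All.lookup a m refl

#-elem : ∀ {n} {S : List (Fin n)} → Unique S → # (λ u → elem u S) ≡ length S
#-elem {n} {[]} U = #-zero {n} (λ _ → refl)
#-elem {S = v ∷ S} U@(_ ∷ U') = trans
  (#-insert v (elem-false S (Unique-∉ U)) (elem-complete {xs = v ∷ S} (here refl)) (λ u ne → sym (cong (_∨ elem u S) (==-false ne))))
  (cong suc (#-elem U'))

∣tabulate∣ : ∀ {n} (f : VSet n) → Sub.∣ tabulate f ∣ ≡ # f
∣tabulate∣ {zero} f = refl
∣tabulate∣ {suc n} f with f zero
... | true = cong suc (∣tabulate∣ (f ∘ suc))
... | false = ∣tabulate∣ (f ∘ suc)

∣tabulate∩tabulate∣ : ∀ {n} (f g : VSet n) → Sub.∣ tabulate f Sub.∩ tabulate g ∣ ≡ # (λ u → f u ∧ g u)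
∣tabulate∩tabulate∣ {zero} f g = refl
∣tabulate∩tabulate∣ {suc n} f g with f zero ∧ g zero
... | true = cong suc (∣tabulate∩tabulate∣ (f ∘ suc) (g ∘ suc))
... | false = ∣tabulate∩tabulate∣ (f ∘ suc) (g ∘ suc)

module _ {n : ℕ} (G : Graph n) where

  -- The degree modulo 2 for lists without repetition. Written as an exclusive or, it turns unions
  -- and incidences in a tree into linear algebra over the field with two elements.
  parity : Fin n → List (Fin n) → Bool
  parity v [] = false
  parity v (u ∷ S) = adj G v u xor parity v S

  record Odd (S : List (Fin n)) : Set where
    constructor mkOdd
    field
      unique : Unique S
      odd-at : ∀ {v} → v ∈ S → parity v S ≡ true

  odd-# : ∀ v {S} → Unique S → odd (# (λ u → elem u S ∧ adj G v u)) ≡ parity v S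
  odd-# v {[]} U = cong odd (#-zero {n} (λ _ → refl))
  odd-# v {w ∷ S} U@(_ ∷ U') with adj G v w in eq
  ... | true = trans (cong odd (#-insert {f = λ u → elem u S ∧ adj G v u} w
                 (cong (_∧ adj G v w) (elem-false S (Unique-∉ U)))
                 (∧-intro (elem-complete {xs = w ∷ S} (here refl)) eq)
                 (λ u ne → cong (λ b → (b ∨ elem u S) ∧ adj G v u) (sym (==-false ne)))))
               (cong not (odd-# v U'))
  ... | false = trans (cong odd (#-cong same)) (odd-# v U')
    where
    same : ∀ u → ((u == w) ∨ elem u S) ∧ adj G v u ≡ elem u S ∧ adj G v u
    same u with u ≟ w
    ... | yes refl rewrite eq = ∧-comm false (elem u S)
    ... | no _ = refl

  Odd⇒≤Fo : ∀ {m S} → IsFo G m → Odd S → length S ≤ m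
  Odd⇒≤Fo {m} {S} (_ , maximal) (mkOdd U o) =
    ≤-trans (≤-reflexive (sym (trans (∣tabulate∣ f) (#-elem U)))) (maximal (tabulate f) isOdd)
    where
    f : VSet n
    f u = elem u S
    isOdd : IsOddInduced G (tabulate f)
    isOdd v v∈ = odd⇒%2 (degIn G (tabulate f) v) (trans (cong odd (∣tabulate∩tabulate∣ f (adj G v)))
      (trans (odd-# v U) (o (elem-sound S (trans (sym (lookup∘tabulate f v)) ([]=⇒lookup v∈))))))

  parity-++ : ∀ v S S' → parity v (S ++ S') ≡ parity v S xor parity v S'
  parity-++ v [] S' = refl
  parity-++ v (u ∷ S) S' = trans (cong (adj G v u xor_) (parity-++ v S S')) (sym (xor-assoc (adj G v u) _ _))

  parity-zero : ∀ v S → (∀ {u} → u ∈ S → adj G v u ≡ false) → parity v S ≡ false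
  parity-zero v [] p = refl
  parity-zero v (u ∷ S) p rewrite p (here refl) = parity-zero v S (p ∘ there)

  -- Parts without edges between them do not affect each other's degrees.
  Odd-++ : ∀ {S S'} → Odd S → Odd S' → (∀ {u w} → u ∈ S → w ∈ S' → u ≢ w × adj G u w ≡ false) → Odd (S ++ S')
  Odd-++ {S} {S'} (mkOdd U o) (mkOdd U' o') sep = mkOdd (++⁺ U U' (λ (p , q) → proj₁ (sep p q) refl)) at
    where
    at : ∀ {v} → v ∈ S ++ S' → parity v (S ++ S') ≡ true
    at {v} m with ∈-++⁻ S m
    ... | inj₁ p = trans (parity-++ v S S') (cong₂ _xor_ (o p) (parity-zero v S' (λ q → proj₂ (sep p q))))
    ... | inj₂ q = trans (parity-++ v S S') (cong₂ _xor_ (parity-zero v S (λ p → trans (Graph.sym G v _) (proj₂ (sep p q)))) (o' q))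

-- Line graphs of trees

≡ᵇ-refl : ∀ k → (k ≡ᵇ k) ≡ true
≡ᵇ-refl zero = refl
≡ᵇ-refl (suc k) = ≡ᵇ-refl k

≡ᵇ-sound : ∀ {j k} → (j ≡ᵇ k) ≡ true → j ≡ k
≡ᵇ-sound {j} {k} p = ≡ᵇ⇒≡ j k (subst (T) (sym p) tt)

≡ᵇ-false : ∀ {j k} → j ≢ k → (j ≡ᵇ k) ≡ false
≡ᵇ-false ne = ¬true⇒false (ne ∘ ≡ᵇ-sound)

-- Counting nodes below a bound, and the parity of such counts

count : ℕ → (ℕ → Bool) → ℕ
count zero f = 0
count (suc h) f = 𝟙 (f h) + count h f

count-cong : ∀ h {f g} → (∀ {z} → z < h → f z ≡ g z) → count h f ≡ count h g
count-cong zero p = refl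
count-cong (suc h) p = cong₂ _+_ (cong 𝟙 (p ≤-refl)) (count-cong h (λ q → p (m≤n⇒m≤1+n q)))

𝟙≤1 : ∀ b → 𝟙 b ≤ 1
𝟙≤1 true = ≤-refl
𝟙≤1 false = z≤n

count-change : ∀ h {f g} x → (∀ z → z ≢ x → f z ≡ g z) → count h f ≤ suc (count h g)
count-change zero x p = z≤n
count-change (suc h) {f} {g} x p with h ℕₚ.≟ x
... | yes refl = +-mono-≤ (𝟙≤1 (f h)) (≤-trans (≤-reflexive (count-cong h (λ q → p _ (<⇒≢ q)))) (ℕₚ.m≤n+m _ (𝟙 (g h))))
... | no ne rewrite p h ne = ≤-trans (ℕₚ.+-monoʳ-≤ (𝟙 (g h)) (count-change h x p)) (≤-reflexive (+-suc _ _))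

count-complement : ∀ h f → count h f + count h (not ∘ f) ≡ h
count-complement zero f = refl
count-complement (suc h) f with f h
... | true = cong suc (count-complement h f)
... | false = trans (+-suc _ _) (cong suc (count-complement h f))

xorSum : ℕ → (ℕ → Bool) → Bool
xorSum zero f = false
xorSum (suc h) f = f h xor xorSum h f

odd-count : ∀ h f → odd (count h f) ≡ xorSum h f
odd-count zero f = refl
odd-count (suc h) f with f h
... | true = cong not (odd-count h f)
... | false = odd-count h f

xorSum-flip-outside : ∀ h {z f} → h ≤ z → xorSum h (λ y → (z ≡ᵇ y) xor f y) ≡ xorSum h f
xorSum-flip-outside zero p = refl
xorSum-flip-outside (suc h) {z} {f} p rewrite ≡ᵇ-false {z} {h} (λ e → <⇒≢ p (sym e)) =
  cong (f h xor_) (xorSum-flip-outside h (≤-trans (n≤1+n h) p))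

xorSum-flip : ∀ h {z f} → z < h → xorSum h (λ y → (z ≡ᵇ y) xor f y) ≡ not (xorSum h f)
xorSum-flip (suc h) {z} {f} z<h with m≤n⇒m<n∨m≡n (≤-pred z<h)
... | inj₂ refl rewrite ≡ᵇ-refl z | xorSum-flip-outside z {z} {f} ≤-refl = not-xor (f z) (xorSum z f)
  where
  not-xor : ∀ a b → not a xor b ≡ not (a xor b)
  not-xor true b = sym (not-involutive b)
  not-xor false b = refl
... | inj₁ lt rewrite ≡ᵇ-false (<⇒≢ lt) | xorSum-flip h {f = f} lt = xor-not (f h) (xorSum h f)
  where
  xor-not : ∀ a b → a xor not b ≡ not (a xor b)
  xor-not true b = refl
  xor-not false b = refl

-- In a tree, `head` is the newer end: the node that is created together with the edge.
record Edge (n : ℕ) : Set where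
  constructor edge
  field
    vertex : Fin n
    tail head : ℕ
open Edge public

-- The two ends of a tree edge differ, so the exclusive or agrees with incidence; it makes `degree`
-- additive.
inc : ∀ {n} → Edge n → ℕ → Bool
inc e z = (tail e ≡ᵇ z) xor (head e ≡ᵇ z)

degree : ∀ {n} → List (Edge n) → ℕ → Bool
degree [] z = false
degree (e ∷ F) z = inc e z xor degree F z

Alternating : ∀ {n} → (ℕ → Bool) → List (Edge n) → Set
Alternating t F = ∀ {e} → e ∈ F → t (head e) ≡ not (t (tail e))

-- An edge has a single end on the side `t`, so adding it changes the degree parity of only one node
-- counted here.
count-degree : ∀ {n} h t (F : List (Edge n)) → Alternating t F → count h (λ z → t z ∧ degree F z) ≤ length F
count-degree h t [] alt = ≤-reflexive (zero-count h)
  where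
  zero-count : ∀ h → count h (λ z → t z ∧ false) ≡ 0
  zero-count zero = refl
  zero-count (suc h) with t h
  ... | true = zero-count h
  ... | false = zero-count h
count-degree h t (e ∷ F) alt with by-cases (t (tail e))
... | inj₁ p = ≤-trans (count-change h (tail e) same) (s≤s (count-degree h t F (alt ∘ there)))
  where
  same : ∀ z → z ≢ tail e → t z ∧ degree (e ∷ F) z ≡ t z ∧ degree F z
  same z ne rewrite ≡ᵇ-false (ne ∘ sym) with head e ℕₚ.≟ z
  ... | yes refl rewrite alt (here refl) | p = refl
  ... | no ne' rewrite ≡ᵇ-false ne' = refl
... | inj₂ p = ≤-trans (count-change h (head e) same) (s≤s (count-degree h t F (alt ∘ there)))
  where
  same : ∀ z → z ≢ head e → t z ∧ degree (e ∷ F) z ≡ t z ∧ degree F z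
  same z ne rewrite ≡ᵇ-false (ne ∘ sym) with tail e ℕₚ.≟ z
  ... | yes refl rewrite p = refl
  ... | no ne' rewrite ≡ᵇ-false ne' = refl

module _ {n : ℕ} (G : Graph n) where

  -- A tree H on the nodes 0, …, h − 1 whose edges are vertices of G, such that
  -- two of them are adjacent in G exactly when they share a node of H.
  data LineTree : ℕ → List (Edge n) → Set where
    root : LineTree 1 []
    leaf : ∀ {h L} → LineTree h L → ∀ v z → z < h → v ∉ map vertex L
         → (∀ {e} → e ∈ L → adj G v (vertex e) ≡ inc e z)
         → LineTree (suc h) (edge v z h ∷ L)

  tail<head : ∀ {h L} → LineTree h L → ∀ {e} → e ∈ L → tail e < head e
  tail<head (leaf T v z z<h _ _) (here refl) = z<h
  tail<head (leaf T v z z<h _ _) (there p) = tail<head T p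

  head< : ∀ {h L} → LineTree h L → ∀ {e} → e ∈ L → head e < h
  head< (leaf T v z z<h _ _) (here refl) = ≤-refl
  head< (leaf T v z z<h _ _) (there p) = m≤n⇒m≤1+n (head< T p)

  tail< : ∀ {h L} → LineTree h L → ∀ {e} → e ∈ L → tail e < h
  tail< T p = <-trans (tail<head T p) (head< T p)

  inc-fresh : ∀ {h L} → LineTree h L → ∀ {e} → e ∈ L → inc e h ≡ false
  inc-fresh T p rewrite ≡ᵇ-false (<⇒≢ (tail< T p)) | ≡ᵇ-false (<⇒≢ (head< T p)) = refl

  -- Every node except the root 0 is created by exactly one edge.
  head-injective : ∀ {h L} → LineTree h L → ∀ {e f} → e ∈ L → f ∈ L → head e ≡ head f → e ≡ f
  head-injective (leaf T _ _ _ _ _) (here refl) (here refl) _ = refl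
  head-injective (leaf T _ _ _ _ _) (here refl) (there q) eq = ⊥-elim (<⇒≢ (head< T q) (sym eq))
  head-injective (leaf T _ _ _ _ _) (there p) (here refl) eq = ⊥-elim (<⇒≢ (head< T p) eq)
  head-injective (leaf T _ _ _ _ _) (there p) (there q) eq = head-injective T p q eq

  vertex-injective : ∀ {h L} → LineTree h L → ∀ {e f} → e ∈ L → f ∈ L → vertex e ≡ vertex f → e ≡ f
  vertex-injective (leaf T _ _ _ _ _) (here refl) (here refl) _ = refl
  vertex-injective (leaf T _ _ _ v∉ _) (here refl) (there q) refl = ⊥-elim (v∉ (∈-map⁺ vertex q))
  vertex-injective (leaf T _ _ _ v∉ _) (there p) (here refl) refl = ⊥-elim (v∉ (∈-map⁺ vertex p))
  vertex-injective (leaf T _ _ _ _ _) (there p) (there q) eq = vertex-injective T p q eq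

  -- For e = f both sides are false: the formula needs no exception on the diagonal.
  adj-inc : ∀ {h L} → LineTree h L → ∀ {e f} → e ∈ L → f ∈ L
          → adj G (vertex e) (vertex f) ≡ inc f (tail e) xor inc f (head e)
  adj-inc (leaf {h} T v z z<h _ _) (here refl) (here refl)
    rewrite ≡ᵇ-refl z | ≡ᵇ-refl h | ≡ᵇ-false (<⇒≢ z<h) | ≡ᵇ-false (λ e → <⇒≢ z<h (sym e)) = irref G v
  adj-inc (leaf T v z z<h _ spec) {f = f} (here refl) (there q) rewrite inc-fresh T q = trans (spec q) (xor-comm false (inc f z))
  adj-inc (leaf {h} T v z z<h _ spec) {e} {f} (there p) (here refl) = trans (Graph.sym G (vertex e) v) (trans (spec p) goal)
    where
    flip : ∀ a b → (a ≡ᵇ b) ≡ (b ≡ᵇ a)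
    flip zero zero = refl
    flip zero (suc b) = refl
    flip (suc a) zero = refl
    flip (suc a) (suc b) = flip a b
    goal : inc e z ≡ ((z ≡ᵇ tail e) xor (h ≡ᵇ tail e)) xor ((z ≡ᵇ head e) xor (h ≡ᵇ head e))
    goal rewrite ≡ᵇ-false {h} (λ q → <⇒≢ (tail< T p) (sym q)) | ≡ᵇ-false {h} (λ q → <⇒≢ (head< T p) (sym q))
               | flip z (tail e) | flip z (head e) | xor-comm (tail e ≡ᵇ z) false | xor-comm (head e ≡ᵇ z) false = refl
  adj-inc (leaf T _ _ _ _ _) (there p) (there q) = adj-inc T p q

  bipartition : ∀ {h L} → LineTree h L → ∃ λ t → Alternating t L
  bipartition root = (λ _ → true) , λ ()
  bipartition (leaf {h} {L} T v z z<h _ _) with bipartition T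
  ... | t , alt = t' , alt'
    where
    t' : ℕ → Bool
    t' y with y ℕₚ.≟ h
    ... | yes _ = not (t z)
    ... | no _ = t y
    old : ∀ {y} → y < h → t' y ≡ t y
    old {y} lt with y ℕₚ.≟ h
    ... | yes refl = ⊥-elim (<-irrefl refl lt)
    ... | no _ = refl
    new : t' h ≡ not (t z)
    new with h ℕₚ.≟ h
    ... | yes _ = refl
    ... | no ne = ⊥-elim (ne refl)
    alt' : Alternating t' (edge v z h ∷ L)
    alt' (here refl) = trans new (cong not (sym (old z<h)))
    alt' (there p) = trans (old (head< T p)) (trans (alt p) (cong not (sym (old (tail< T p)))))

  degree-fresh : ∀ {h L} → LineTree h L → ∀ F → (∀ {e} → e ∈ F → e ∈ L) → degree F h ≡ false
  degree-fresh T [] sub = refl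
  degree-fresh T (e ∷ F) sub rewrite inc-fresh T (sub (here refl)) = degree-fresh T F (sub ∘ there)

  -- T-joins in a tree: an even set of nodes is the set of odd-degree nodes of some edge set. Leaves
  -- are peeled off from the newest, whose edge is forced in or out.
  join : ∀ {h L} → LineTree h L → ∀ D → xorSum h D ≡ false
       → ∃ λ F → (∀ {e} → e ∈ F → e ∈ L) × Unique (map vertex F) × (∀ {z} → z < h → degree F z ≡ D z)
  join root D p = [] , (λ ()) , [] , λ { {zero} (s≤s z≤n) → sym (trans (xor-comm false (D 0)) p) }
  join (leaf {h} {L} T v z z<h v∉ _) D p with D h in Dh
  ... | false with join T D p
  ...   | F , sub , U , deg = F , there ∘ sub , U , deg'
    where
    deg' : ∀ {y} → y < suc h → degree F y ≡ D y
    deg' lt with m≤n⇒m<n∨m≡n (≤-pred lt)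
    ... | inj₁ lt' = deg lt'
    ... | inj₂ refl = trans (degree-fresh T F sub) (sym Dh)
  -- The leaf `h` must have odd degree, so its only edge is taken; this toggles the demand at the
  -- other end `z`.
  join (leaf {h} {L} T v z z<h v∉ _) D p | true
    with join T (λ y → (z ≡ᵇ y) xor D y) (trans (xorSum-flip h z<h) p)
  ...   | F , sub , U , deg = edge v z h ∷ F , sub' , Unique-∷ v∉F U , deg'
    where
    sub' : ∀ {e} → e ∈ edge v z h ∷ F → e ∈ edge v z h ∷ L
    sub' (here refl) = here refl
    sub' (there q) = there (sub q)
    v∉F : v ∉ map vertex F
    v∉F m with ∈-map⁻ vertex m
    ... | e , q , refl = v∉ (∈-map⁺ vertex (sub q))
    deg' : ∀ {y} → y < suc h → ((z ≡ᵇ y) xor (h ≡ᵇ y)) xor degree F y ≡ D y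
    deg' {y} lt with m≤n⇒m<n∨m≡n (≤-pred lt)
    ... | inj₂ refl rewrite ≡ᵇ-false (<⇒≢ z<h) | ≡ᵇ-refl h | degree-fresh T F sub = sym Dh
    ... | inj₁ lt' rewrite ≡ᵇ-false {h} {y} (λ e → <⇒≢ lt' (sym e)) | deg lt' with z ≡ᵇ y
    ...   | true = not-involutive (D y)
    ...   | false = refl

  -- Neighbours of an edge in the line graph are counted at its two ends. If the edge itself lies in
  -- `F`, it is counted at both and cancels.
  parity-degree : ∀ {h L} → LineTree h L → ∀ F → (∀ {e} → e ∈ F → e ∈ L) → ∀ {e} → e ∈ L
                → parity G (vertex e) (map vertex F) ≡ degree F (tail e) xor degree F (head e)
  parity-degree T [] sub p = refl
  parity-degree T (f ∷ F) sub {e} p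
    rewrite adj-inc T p (sub (here refl)) | parity-degree T F (sub ∘ there) p =
    interchange (inc f (tail e)) (inc f (head e)) (degree F (tail e)) (degree F (head e))
    where
    interchange : ∀ a b c d → (a xor b) xor (c xor d) ≡ (a xor c) xor (b xor d)
    interchange a b c d = trans (xor-assoc a b (c xor d))
      (trans (cong (a xor_) (trans (sym (xor-assoc b c d)) (trans (cong (_xor d) (xor-comm b c)) (xor-assoc c b d))))
             (sym (xor-assoc a c (b xor d))))

  odd-2* : ∀ m → odd (2 * m) ≡ false
  odd-2* zero = refl
  odd-2* (suc m) rewrite +-suc m (m + 0) = trans (not-involutive _) (odd-2* m)

  -- A T-join for the whole side works when the side has exactly `2 * m` nodes, an even number. A
  -- larger side is cut down by removing the newest leaves of the tree.
  LineTree-odd-side : ∀ {h L} → LineTree h L → ∀ t → Alternating t L → ∀ m → 2 * m ≤ count h t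
                    → ∃ λ S → Odd G S × (∀ {v} → v ∈ S → v ∈ map vertex L) × 2 * m ≤ length S
  LineTree-odd-side {h} {L} T t alt m le with m≤n⇒m<n∨m≡n le
  ... | inj₂ eq with join T t (trans (sym (odd-count h t)) (trans (cong odd (sym eq)) (odd-2* m)))
  ...   | F , sub , U , deg = map vertex F , mkOdd U odd-at , inL , long
    where
    odd-at : ∀ {v} → v ∈ map vertex F → parity G v (map vertex F) ≡ true
    odd-at q with ∈-map⁻ vertex q
    -- The degrees in `F` are odd exactly on the side `t`, and an edge has one end on each side, so
    -- the parities at its ends add up to 1.
    ... | e , e∈ , refl = trans (parity-degree T F sub (sub e∈))
          (trans (cong₂ _xor_ (deg (tail< T (sub e∈))) (trans (deg (head< T (sub e∈))) (alt (sub e∈)))) (b-xor-not (t (tail e))))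
      where
      b-xor-not : ∀ b → b xor not b ≡ true
      b-xor-not true = refl
      b-xor-not false = refl
    inL : ∀ {v} → v ∈ map vertex F → v ∈ map vertex L
    inL q with ∈-map⁻ vertex q
    ... | e , e∈ , refl = ∈-map⁺ vertex (sub e∈)
    idem : ∀ b → b ≡ b ∧ b
    idem true = refl
    idem false = refl
    long : 2 * m ≤ length (map vertex F)
    long = ≤-trans (≤-reflexive (trans eq (count-cong h (λ lt → trans (idem (t _)) (cong (t _ ∧_) (sym (deg lt)))))))
      (≤-trans (count-degree h t F (alt ∘ sub)) (≤-reflexive (sym (length-map vertex F))))
  LineTree-odd-side root t alt zero le | inj₁ lt = [] , mkOdd [] (λ ()) , (λ ()) , z≤n
  LineTree-odd-side root t alt (suc m) le | inj₁ lt =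
    ⊥-elim (<-irrefl refl (≤-trans (s≤s (s≤s z≤n)) (≤-trans lt (≤-trans (≤-reflexive (+-identityʳ _)) (𝟙≤1 (t 0))))))
  -- Dropping the newest leaf lowers the count by at most one, so the strict inequality leaves at
  -- least `2 * m`.
  LineTree-odd-side (leaf {h} T _ _ _ _ _) t alt m le | inj₁ lt
    with LineTree-odd-side T t (alt ∘ there) m (≤-pred (≤-trans lt (+-mono-≤ (𝟙≤1 (t h)) ≤-refl)))
  ... | S , o , inL , long = S , o , there ∘ inL , long

  -- One of the two sides has at least half of the nodes.
  LineTree-odd : ∀ {h L} → LineTree h L → ∀ m → 4 * m ≤ h
               → ∃ λ S → Odd G S × (∀ {v} → v ∈ S → v ∈ map vertex L) × 2 * m ≤ length S
  LineTree-odd {h} T m le with bipartition T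
  ... | t , alt with ℕₚ.≤-total (2 * m) (count h t)
  ...   | inj₁ p = LineTree-odd-side T t alt m p
  ...   | inj₂ p = LineTree-odd-side T (not ∘ t) (cong not ∘ alt) m
          (ℕₚ.+-cancelˡ-≤ (2 * m) _ _ (≤-trans (≤-reflexive (sym double)) (≤-trans le
            (≤-trans (≤-reflexive (sym (count-complement h t))) (ℕₚ.+-monoˡ-≤ _ p)))))
    where
    double : 4 * m ≡ 2 * m + 2 * m
    double = ℕₚ.*-distribʳ-+ m 2 2

-- Attaching a vertex to the line graph of a tree

bool-ext : ∀ {a b} → (a ≡ true → b ≡ true) → (b ≡ true → a ≡ true) → a ≡ b
bool-ext {true} p q = sym (p refl)
bool-ext {false} {true} p q = q refl
bool-ext {false} {false} p q = refl

search : ∀ {A : Set} (f : A → Bool) L → (∀ {e} → e ∈ L → f e ≡ true) ⊎ (∃ λ e → e ∈ L × f e ≡ false)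
search f [] = inj₁ λ ()
search f (e ∷ L) with f e in eq | search f L
... | false | _ = inj₂ (e , here refl , eq)
... | true | inj₂ (g , p , q) = inj₂ (g , there p , q)
... | true | inj₁ all = inj₁ λ { (here refl) → eq ; (there p) → all p }

inc-ends : ∀ {n} (e : Edge n) {z} → inc e z ≡ true → tail e ≡ z ⊎ head e ≡ z
inc-ends e {z} p with tail e ≡ᵇ z in a
... | true = inj₁ (≡ᵇ-sound a)
... | false = inj₂ (≡ᵇ-sound p)

inc-tail : ∀ {n} (e : Edge n) → tail e < head e → inc e (tail e) ≡ true
inc-tail e lt rewrite ≡ᵇ-refl (tail e) | ≡ᵇ-false {head e} {tail e} (λ q → <⇒≢ lt (sym q)) = refl

inc-head : ∀ {n} (e : Edge n) → tail e < head e → inc e (head e) ≡ true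
inc-head e lt rewrite ≡ᵇ-refl (head e) | ≡ᵇ-false (<⇒≢ lt) = refl

module _ {n : ℕ} (G : Graph n) where

  adj-sym : ∀ {u v b} → adj G u v ≡ b → adj G v u ≡ b
  adj-sym {u} {v} p = trans (Graph.sym G v u) p

  adj⇒≢ : ∀ {u v} → adj G u v ≡ true → u ≢ v
  adj⇒≢ {u} p refl = true≢false p (irref G u)

  Independent : VSet n → Set
  Independent I = ∀ u v → I u ≡ true → I v ≡ true → adj G u v ≡ false

  module _ {h : ℕ} {L : List (Edge n)} (T : LineTree G h L) where

    -- H has no parallel edges: equally oriented ones share their head, and oppositely oriented ones
    -- contradict tail < head.
    ends-determine : ∀ {e f p q} → e ∈ L → f ∈ L → p ≢ q → inc e p ≡ true → inc e q ≡ true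
                   → inc f p ≡ true → inc f q ≡ true → e ≡ f
    ends-determine {e} {f} e∈ f∈ ne ep eq fp fq
      with inc-ends e ep | inc-ends e eq | inc-ends f fp | inc-ends f fq
    ... | inj₁ refl | inj₁ b | _ | _ = ⊥-elim (ne b)
    ... | inj₂ refl | inj₂ b | _ | _ = ⊥-elim (ne b)
    ... | _ | _ | inj₁ c | inj₁ d = ⊥-elim (ne (trans (sym c) d))
    ... | _ | _ | inj₂ c | inj₂ d = ⊥-elim (ne (trans (sym c) d))
    ... | inj₁ _ | inj₂ b | inj₁ _ | inj₂ d = head-injective G T e∈ f∈ (trans b (sym d))
    ... | inj₂ a | inj₁ _ | inj₂ c | inj₁ _ = head-injective G T e∈ f∈ (trans a (sym c))
    ... | inj₁ refl | inj₂ refl | inj₂ c | inj₁ d =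
      ⊥-elim (<-asym (tail<head G T e∈) (subst (_< _) d (subst (tail f <_) c (tail<head G T f∈))))
    ... | inj₂ refl | inj₁ refl | inj₁ c | inj₂ d =
      ⊥-elim (<-asym (tail<head G T e∈) (subst (_< _) c (subst (tail f <_) d (tail<head G T f∈))))

    adj⇒share : ∀ {e f} → e ∈ L → f ∈ L → adj G (vertex e) (vertex f) ≡ true
              → ∃ λ z → inc e z ≡ true × inc f z ≡ true
    adj⇒share {e} {f} e∈ f∈ p with by-cases (inc f (tail e)) | trans (sym (adj-inc G T e∈ f∈)) p
    ... | inj₁ q | _ = tail e , inc-tail e (tail<head G T e∈) , q
    ... | inj₂ q | r rewrite q = head e , inc-head e (tail<head G T e∈) , r

    share⇒adj : ∀ {e f z} → e ∈ L → f ∈ L → e ≢ f → inc e z ≡ true → inc f z ≡ true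
              → adj G (vertex e) (vertex f) ≡ true
    share⇒adj {e} {f} e∈ f∈ ne ez fz = trans (adj-inc G T e∈ f∈) (go (inc-ends e ez))
      where
      lt = tail<head G T e∈
      both : inc f (tail e) ≡ true → inc f (head e) ≡ true → ⊥
      both a b = ne (ends-determine e∈ f∈ (<⇒≢ lt) (inc-tail e lt) (inc-head e lt) a b)
      go : tail e ≡ _ ⊎ head e ≡ _ → inc f (tail e) xor inc f (head e) ≡ true
      go (inj₁ refl) = cong₂ _xor_ fz (¬true⇒false (both fz))
      go (inj₂ refl) = cong₂ _xor_ (¬true⇒false (λ a → both a fz)) fz

    sides-differ : ∀ {t e p q} → Alternating t L → e ∈ L → p ≢ q → inc e p ≡ true → inc e q ≡ true → t p ≡ not (t q)
    sides-differ {t} {e} alt e∈ ne ep eq with inc-ends e ep | inc-ends e eq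
    ... | inj₁ refl | inj₁ b = ⊥-elim (ne b)
    ... | inj₂ refl | inj₂ b = ⊥-elim (ne b)
    ... | inj₂ refl | inj₁ refl = alt e∈
    ... | inj₁ refl | inj₂ refl = trans (sym (not-involutive _)) (cong not (sym (alt e∈)))

    -- H has no triangles.
    opposite-ends-nonadjacent : ∀ {e f g p q} → e ∈ L → f ∈ L → g ∈ L → p ≢ q → inc e p ≡ true → inc e q ≡ true
      → f ≢ e → g ≢ e → inc f p ≡ true → inc g q ≡ true → adj G (vertex f) (vertex g) ≡ false
    opposite-ends-nonadjacent {e} {f} {g} {p} {q} e∈ f∈ g∈ p≢q ep eq f≢e g≢e fp gq = ¬true⇒false no-share
      where
      no-share : adj G (vertex f) (vertex g) ≡ true → ⊥
      no-share a with adj⇒share f∈ g∈ a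
      ... | z , fz , gz with z ℕₚ.≟ p | z ℕₚ.≟ q
      ...   | yes refl | _ = g≢e (ends-determine g∈ e∈ p≢q gz gq ep eq)
      ...   | _ | yes refl = f≢e (ends-determine f∈ e∈ p≢q fp fz ep eq)
      -- Now `p`, `q`, `z` are pairwise joined, which the 2-colouring `t` of the tree forbids.
      ...   | no z≢p | no z≢q with bipartition G T
      ...     | t , alt with t z | sides-differ {t} alt f∈ z≢p fz fp | sides-differ {t} alt g∈ z≢q gz gq | sides-differ {t} alt e∈ p≢q ep eq
      ...       | _ | a₁ | a₂ | a₃ rewrite a₃ with t q | a₁ | a₂
      ...         | true | refl | ()
      ...         | false | refl | ()

  touches : Fin n → List (Fin n) → Bool
  touches v [] = false
  touches v (u ∷ S) = adj G v u ∨ touches v S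

  touches-complete : ∀ {v u S} → u ∈ S → adj G v u ≡ true → touches v S ≡ true
  touches-complete (here refl) p = ∨-introˡ p
  touches-complete (there q) p = ∨-introʳ (touches-complete q p)

  touches-sound : ∀ v S → touches v S ≡ true → ∃ λ u → u ∈ S × adj G v u ≡ true
  touches-sound v (u ∷ S) p with ∨-elim p
  ... | inj₁ q = u , here refl , q
  ... | inj₂ q with touches-sound v S q
  ...   | w , m , r = w , there m , r

  module _ (claw-free : ClawFree G) where

    no-claw : ∀ {A : Set} {c a b d} → adj G c a ≡ true → adj G c b ≡ true → adj G c d ≡ true
            → a ≢ b → a ≢ d → b ≢ d → adj G a b ≡ false → adj G a d ≡ false → adj G b d ≡ false → A
    no-claw {c = c} {a} {b} {d} p q r x y z α β γ = ⊥-elim (claw-free c a b d p q r x y z (α , β , γ))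

    -- The vertex `w`, adjacent to `v` but to nothing in the tree, supplies the third leaf of claws
    -- centred at `v`. The aim is that `v` can be added as a new edge hanging at a single node.
    module Attach {h : ℕ} {L : List (Edge n)} (T : LineTree G h L) (I : VSet n) (I-independent : Independent I)
      (leaf∈I : ∀ {e} → e ∈ L → ∀ {z} → inc e z ≡ true → (∀ {f} → f ∈ L → inc f z ≡ true → f ≡ e) → I (vertex e) ≡ true)
      (v w : Fin n) (v∉ : v ∉ map vertex L) (w∉ : w ∉ map vertex L)
      (vw : adj G v w ≡ true) (w-far : ∀ {e} → e ∈ L → adj G w (vertex e) ≡ false) where

      a : Edge n → Bool
      a e = adj G v (vertex e)

      ≢v : ∀ {e} → e ∈ L → vertex e ≢ v
      ≢v e∈ refl = v∉ (∈-map⁺ vertex e∈)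

      vertex-≢ : ∀ {e f} → e ∈ L → f ∈ L → e ≢ f → vertex e ≢ vertex f
      vertex-≢ e∈ f∈ ne eq = ne (vertex-injective G T e∈ f∈ eq)

      _≟ₑ_ : ∀ {e f} → e ∈ L → f ∈ L → e ≡ f ⊎ e ≢ f
      _≟ₑ_ {e} {f} e∈ f∈ with head e ℕₚ.≟ head f
      ... | yes eq = inj₁ (head-injective G T e∈ f∈ eq)
      ... | no ne = inj₂ (λ eq → ne (cong head eq))

      -- Otherwise v would be the centre of a claw with the third leaf w.
      neighbours-clique : ∀ {e f} → e ∈ L → f ∈ L → e ≢ f → a e ≡ true → a f ≡ true → adj G (vertex e) (vertex f) ≡ true
      neighbours-clique {e} {f} e∈ f∈ ne ae af with by-cases (adj G (vertex e) (vertex f))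
      ... | inj₁ p = p
      ... | inj₂ p = no-claw ae af vw (vertex-≢ e∈ f∈ ne) (≢w e∈) (≢w f∈) p (adj-sym (w-far e∈)) (adj-sym (w-far f∈))
        where
        ≢w : ∀ {e} → e ∈ L → vertex e ≢ w
        ≢w e∈ refl = w∉ (∈-map⁺ vertex e∈)

      Full : ℕ → Set
      Full z = ∀ {e} → e ∈ L → inc e z ≡ true → a e ≡ true

      full? : ∀ z → Full z ⊎ (∃ λ e → e ∈ L × inc e z ≡ true × a e ≡ false)
      full? z with search (λ e → not (inc e z) ∨ a e) L
      ... | inj₁ all = inj₁ λ {e} e∈ p → full e∈ p
        where
        full : ∀ {e} → e ∈ L → inc e z ≡ true → a e ≡ true
        full {e} e∈ p with inc e z | all e∈
        full e∈ refl | true | q = q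
      ... | inj₂ (e , e∈ , q) with inc e z in eq
      ...   | true = inj₂ (e , e∈ , eq , q)

      Attached : Set
      Attached = ∃ λ z → ∀ {e} → e ∈ L → a e ≡ inc e z

      attached-at : ∀ {z} → Full z → (∀ {e} → e ∈ L → a e ≡ true → inc e z ≡ true) → Attached
      attached-at {z} full only = z , λ e∈ → bool-ext (only e∈) (full e∈)

      -- The neighbours of `v` form a clique, so `e₁` passes through `q` and no third edge can sit
      -- at `p`. Thus `e₀` is a leaf edge at `p`, and it remains to show that `q` is full.
      attached-beyond : ∀ {e₀ e₁ p q} → e₀ ∈ L → e₁ ∈ L → a e₀ ≡ true → a e₁ ≡ true
                      → p ≢ q → inc e₀ p ≡ true → inc e₀ q ≡ true → Full p → inc e₁ p ≡ false → Attached
      attached-beyond {e₀} {e₁} {p} {q} e₀∈ e₁∈ ae₀ ae₁ p≢q e₀p e₀q full-p e₁p̸ = by-q (full? q)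
        where
        e₁≢e₀ : e₁ ≢ e₀
        e₁≢e₀ refl = true≢false e₀p e₁p̸
        other-end : ∀ {e} → e ∈ L → e ≢ e₀ → a e ≡ true → inc e p ≡ false → inc e q ≡ true
        other-end e∈ ne ae ep̸ with adj⇒share T e∈ e₀∈ (neighbours-clique e∈ e₀∈ ne ae ae₀)
        ... | z , ez , e₀z with z ℕₚ.≟ p | z ℕₚ.≟ q
        ...   | yes refl | _ = true≢false ez ep̸
        ...   | _ | yes refl = ez
        ...   | no z≢p | no z≢q with inc-ends e₀ e₀z | inc-ends e₀ e₀p | inc-ends e₀ e₀q
        ...     | inj₁ refl | inj₁ r | _ = ⊥-elim (z≢p r)
        ...     | inj₂ refl | inj₂ r | _ = ⊥-elim (z≢p r)
        ...     | inj₁ refl | _ | inj₁ r = ⊥-elim (z≢q r)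
        ...     | inj₂ refl | _ | inj₂ r = ⊥-elim (z≢q r)
        ...     | inj₁ _ | inj₂ refl | inj₂ r = ⊥-elim (p≢q r)
        ...     | inj₂ _ | inj₁ refl | inj₁ r = ⊥-elim (p≢q r)
        e₁q : inc e₁ q ≡ true
        e₁q = other-end e₁∈ e₁≢e₀ ae₁ e₁p̸
        p-leaf : ∀ {f} → f ∈ L → inc f p ≡ true → f ≡ e₀
        p-leaf {f} f∈ fp with f∈ ≟ₑ e₀∈
        ... | inj₁ eq = eq
        ... | inj₂ ne with f∈ ≟ₑ e₁∈
        ...   | inj₁ refl = true≢false fp e₁p̸
        ...   | inj₂ ne' = true≢false (neighbours-clique f∈ e₁∈ ne' (full-p f∈ fp) ae₁)
                  (opposite-ends-nonadjacent T e₀∈ f∈ e₁∈ p≢q e₀p e₀q ne e₁≢e₀ fp e₁q)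
        by-q : Full q ⊎ (∃ λ e → e ∈ L × inc e q ≡ true × a e ≡ false) → Attached
        by-q (inj₁ full-q) = attached-at full-q only
          where
          only : ∀ {e} → e ∈ L → a e ≡ true → inc e q ≡ true
          only {e} e∈ ae with by-cases (inc e p)
          ... | inj₁ ep rewrite p-leaf e∈ ep = e₀q
          ... | inj₂ ep̸ = other-end e∈ (λ { refl → true≢false e₀p ep̸ }) ae ep̸
        -- If `e₂` at `q` avoids `v`, then `e₁` is a leaf edge as well; so `e₀` and `e₁` both lie in
        -- `I` although they share `q`.
        by-q (inj₂ (e₂ , e₂∈ , e₂q , ae₂)) = true≢false
            (share⇒adj T e₁∈ e₀∈ e₁≢e₀ e₁q e₀q)
            (I-independent _ _ (leaf-e₁ (inc-ends e₁ e₁q)) (leaf∈I e₀∈ e₀p p-leaf))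
          where
          lt = tail<head G T e₁∈
          e₂≢e₁ : e₂ ≢ e₁
          e₂≢e₁ refl = true≢false ae₁ ae₂
          -- A second edge `f` at the far end `r` of `e₁` either avoids `v`, and then `e₁` is the
          -- centre of a claw with leaves `f`, `e₂`, `v`; or it is adjacent to `v`, hence passes
          -- through `q` and equals `e₁`.
          r-leaf : ∀ {r} → r ≢ q → inc e₁ r ≡ true → ∀ {f} → f ∈ L → inc f r ≡ true → f ≡ e₁
          r-leaf {r} r≢q e₁r {f} f∈ fr with f∈ ≟ₑ e₁∈
          ... | inj₁ eq = eq
          ... | inj₂ f≢e₁ with by-cases (a f)
          ...   | inj₂ af = no-claw (adj-sym (share⇒adj T f∈ e₁∈ f≢e₁ fr e₁r)) (adj-sym (share⇒adj T e₂∈ e₁∈ e₂≢e₁ e₂q e₁q)) (adj-sym ae₁)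
                    (vertex-≢ f∈ e₂∈ λ { refl → f≢e₁ (ends-determine T f∈ e₁∈ r≢q fr e₂q e₁r e₁q) }) (≢v f∈) (≢v e₂∈)
                    (opposite-ends-nonadjacent T e₁∈ f∈ e₂∈ r≢q e₁r e₁q f≢e₁ e₂≢e₁ fr e₂q) (adj-sym af) (adj-sym ae₂)
          ...   | inj₁ af with f∈ ≟ₑ e₀∈
          ...     | inj₁ refl = ⊥-elim (e₁≢e₀ (ends-determine T e₁∈ f∈ r≢q e₁r e₁q fr e₀q))
          ...     | inj₂ f≢e₀ with by-cases (inc f p)
          ...       | inj₁ fp = ⊥-elim (f≢e₀ (p-leaf f∈ fp))
          ...       | inj₂ fp̸ = ends-determine T f∈ e₁∈ r≢q fr (other-end f∈ f≢e₀ af fp̸) e₁r e₁q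
          leaf-e₁ : tail e₁ ≡ q ⊎ head e₁ ≡ q → I (vertex e₁) ≡ true
          leaf-e₁ (inj₁ refl) = leaf∈I e₁∈ (inc-head e₁ lt) (r-leaf (λ eq → <⇒≢ lt (sym eq)) (inc-head e₁ lt))
          leaf-e₁ (inj₂ refl) = leaf∈I e₁∈ (inc-tail e₁ lt) (r-leaf (<⇒≢ lt) (inc-tail e₁ lt))

      attached-from : ∀ {e₀ p q} → e₀ ∈ L → a e₀ ≡ true → p ≢ q → inc e₀ p ≡ true → inc e₀ q ≡ true → Full p → Attached
      attached-from {p = p} e₀∈ ae₀ p≢q e₀p e₀q full-p with search (λ e → not (a e) ∨ inc e p) L
      ... | inj₁ all = attached-at full-p λ {e} e∈ ae → subst (λ b → not b ∨ inc e p ≡ true) ae (all e∈)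
      ... | inj₂ (e₁ , e₁∈ , eq) with by-cases (a e₁)
      ...   | inj₁ ae₁ rewrite ae₁ = attached-beyond e₀∈ e₁∈ ae₀ ae₁ p≢q e₀p e₀q full-p eq
      ...   | inj₂ ae₁ rewrite ae₁ = true≢false refl eq

      attached : ∀ {e₀} → e₀ ∈ L → a e₀ ≡ true → Attached
      attached {e₀} e₀∈ ae₀ with full? (tail e₀) | full? (head e₀)
      ... | inj₁ full | _ = attached-from e₀∈ ae₀ (<⇒≢ lt) (inc-tail e₀ lt) (inc-head e₀ lt) full
        where lt = tail<head G T e₀∈
      ... | _ | inj₁ full = attached-from e₀∈ ae₀ (λ eq → <⇒≢ lt (sym eq)) (inc-head e₀ lt) (inc-tail e₀ lt) full
        where lt = tail<head G T e₀∈
      -- If neither end of `e₀` is full, `e₀` is the centre of a claw with leaves `f`, `g`, `v`.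
      ... | inj₂ (f , f∈ , fp , af) | inj₂ (g , g∈ , gq , ag) =
        no-claw (adj-sym (share⇒adj T f∈ e₀∈ f≢e₀ fp (inc-tail e₀ lt))) (adj-sym (share⇒adj T g∈ e₀∈ g≢e₀ gq (inc-head e₀ lt))) (adj-sym ae₀)
          (vertex-≢ f∈ g∈ λ { refl → f≢e₀ (ends-determine T f∈ e₀∈ (<⇒≢ lt) fp gq (inc-tail e₀ lt) (inc-head e₀ lt)) }) (≢v f∈) (≢v g∈)
          (opposite-ends-nonadjacent T e₀∈ f∈ g∈ (<⇒≢ lt) (inc-tail e₀ lt) (inc-head e₀ lt) f≢e₀ g≢e₀ fp gq) (adj-sym af) (adj-sym ag)
        where
        lt = tail<head G T e₀∈
        f≢e₀ : f ≢ e₀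
        f≢e₀ refl = true≢false ae₀ af
        g≢e₀ : g ≢ e₀
        g≢e₀ refl = true≢false ae₀ ag

-- Growing the line graph of a tree through an independent set

module _ {n : ℕ} (G : Graph n) where

  -- The cut form of connectedness: the growing step applies it directly to a closed neighbourhood,
  -- and its failure is a separation without crossing edges.
  Connected : VSet n → Set
  Connected X = ∀ (P : VSet n) {u w} → X u ≡ true → X w ≡ true → P u ≡ true → P w ≡ false
              → ∃₂ λ v₁ v₂ → X v₁ ≡ true × X v₂ ≡ true × P v₁ ≡ true × P v₂ ≡ false × adj G v₁ v₂ ≡ true

  -- `Q` selects the nodes at which leaf edges are controlled. While connecting vertices are being
  -- added, the newest node is exempt.
  LeavesIn : VSet n → (ℕ → Set) → List (Edge n) → Set
  LeavesIn I Q L = ∀ {e} → e ∈ L → ∀ {z} → Q z → inc e z ≡ true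
                 → (∀ {f} → f ∈ L → inc f z ≡ true → f ≡ e) → I (vertex e) ≡ true

  -- After the attachment at `y`, at least two edges meet there, so a defect at `y` is healed and
  -- only the new node `h` may be defective.
  leaves-∷ : ∀ {I h L} → LineTree G h L → ∀ {v y e₀} → e₀ ∈ L → inc e₀ y ≡ true → y < h
           → LeavesIn I (_≢ y) L → LeavesIn I (_≢ h) (edge v y h ∷ L)
  leaves-∷ T {v} {y} e₀∈ e₀y y<h leaves (here refl) {z} z≢h ez alone with inc-ends (edge v y _) ez
  ... | inj₂ eq = ⊥-elim (z≢h (sym eq))
  ... | inj₁ refl = ⊥-elim (<⇒≢ (head< G T e₀∈) (cong head (alone (there e₀∈) e₀y)))
  leaves-∷ {h = h} T {v} {y} e₀∈ e₀y y<h leaves {e} (there e∈) {z} z≢h ez alone with z ℕₚ.≟ y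
  ... | no z≢y = leaves e∈ z≢y ez (alone ∘ there)
  ... | yes refl = ⊥-elim (<⇒≢ (head< G T e∈) (sym (cong head (alone (here refl) (inc-tail (edge v y h) y<h)))))

  -- A newest edge taken from `I` ends the chain of connecting vertices and restores the full
  -- invariant.
  leaves-close : ∀ {I h L v y} → LineTree G h L → I v ≡ true → LeavesIn I (_≢ h) (edge v y h ∷ L)
               → LeavesIn I (λ _ → ⊤) (edge v y h ∷ L)
  leaves-close {h = h} T Iv leaves {e = e} e∈ {z} _ ez alone with z ℕₚ.≟ h
  ... | no z≢h = leaves e∈ z≢h ez alone
  leaves-close T Iv leaves (here refl) _ ez alone | yes refl = Iv
  leaves-close T Iv leaves (there e∈) _ ez alone | yes refl = true≢false ez (inc-fresh G T e∈)

  attach-tip : ∀ {h L v z} → LineTree G h L → z < h → ∀ {u} → adj G u v ≡ true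
             → (∀ {e} → e ∈ L → adj G u (vertex e) ≡ false)
             → ∀ {e} → e ∈ edge v z h ∷ L → adj G u (vertex e) ≡ inc e h
  attach-tip {h} T z<h uv far (here refl) rewrite ≡ᵇ-false (<⇒≢ z<h) | ≡ᵇ-refl h = uv
  attach-tip T z<h uv far (there e∈) = trans (far e∈) (sym (inc-fresh G T e∈))

  module Grow (claw-free : ClawFree G) (X I : VSet n) (connected : Connected X)
    (I⊆X : I ⊆ X) (I-independent : Independent G I)
    (dominating : ∀ v → X v ≡ true → I v ≡ false → ∃ λ i → I i ≡ true × adj G v i ≡ true) where

    -- `R` is the part of `I` still to be reached. Keeping it nonadjacent to the tree lets its
    -- members serve as the far neighbour required for attachment.
    record Partial (R : VSet n) (h : ℕ) (L : List (Edge n)) : Set where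
      field
        tree     : LineTree G h L
        first    : ∃ λ e → e ∈ L
        inX      : ∀ {e} → e ∈ L → X (vertex e) ≡ true
        cover    : ∀ i → I i ≡ true → i ∈ map vertex L ⊎ R i ≡ true
        R⊆I      : R ⊆ I
        fresh    : ∀ {i} → R i ≡ true → i ∉ map vertex L
        separate : ∀ {i} → R i ≡ true → ∀ {e} → e ∈ L → adj G i (vertex e) ≡ false
        leaves   : LeavesIn I (λ _ → ⊤) L

    -- The common last move of both extensions: `u` is the last connecting vertex, and `i` is hung
    -- on the node `g` that `u` created. The older part `L₁` is `L` itself, or `L` with one more
    -- connecting vertex.
    grow-tip : ∀ {R h L g L₁ u y i} → Partial R h L
             → LineTree G g L₁ → y < g → LineTree G (suc g) (edge u y g ∷ L₁) → LeavesIn I (_≢ g) (edge u y g ∷ L₁)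
             → (∀ {e} → e ∈ edge u y g ∷ L₁ → X (vertex e) ≡ true)
             → (∀ {v} → v ∈ map vertex L → v ∈ map vertex L₁)
             → R i ≡ true → adj G i u ≡ true → (∀ {e} → e ∈ L₁ → adj G i (vertex e) ≡ false)
             → (∀ {j} → R j ≡ true → j ∉ u ∷ map vertex L₁)
             → (∀ {j} → R j ≡ true → j ≢ i → ∀ {e} → e ∈ edge u y g ∷ L₁ → adj G j (vertex e) ≡ false)
             → Partial (R ∖ (i ∷ [])) (2 + g) (edge i g (suc g) ∷ edge u y g ∷ L₁)
    grow-tip {R} {L = L} {g} {L₁} {u} {y} {i} P T₁ y<g T leaves' inX' old Ri iu i-far fresh₁ far = record
      { tree = leaf T i g ≤-refl (fresh₁ Ri) (attach-tip T₁ y<g iu i-far)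
      ; first = _ , here refl
      ; inX = λ { (here refl) → I⊆X i (R⊆I i Ri) ; (there e∈) → inX' e∈ }
      ; cover = cover'
      ; R⊆I = λ j Rj → R⊆I j (proj₁ (∖-∈ R (i ∷ []) Rj))
      ; fresh = fresh'
      ; separate = separate'
      ; leaves = leaves-close T (R⊆I i Ri) (leaves-∷ T (here refl) (inc-head (edge u y g) y<g) ≤-refl leaves') }
      where
      open Partial P
      cover' : ∀ j → I j ≡ true → j ∈ i ∷ u ∷ map vertex L₁ ⊎ (R ∖ (i ∷ [])) j ≡ true
      cover' j Ij with j ≟ i | cover j Ij
      ... | yes refl | _ = inj₁ (here refl)
      ... | no _ | inj₁ m = inj₁ (there (there (old m)))
      ... | no ne | inj₂ Rj = inj₂ (∧-intro Rj refl)
      fresh' : ∀ {j} → (R ∖ (i ∷ [])) j ≡ true → j ∉ i ∷ u ∷ map vertex L₁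
      fresh' p with ∖-∈ R (i ∷ []) p
      ... | Rj , ne = λ { (here eq) → ne (here eq) ; (there m) → fresh₁ Rj m }
      separate' : ∀ {j} → (R ∖ (i ∷ [])) j ≡ true → ∀ {e} → e ∈ edge i g (suc g) ∷ edge u y g ∷ L₁ → adj G j (vertex e) ≡ false
      separate' {j} p e∈ with ∖-∈ R (i ∷ []) p
      separate' {j} p (here refl) | Rj , ne = I-independent _ _ (R⊆I j Rj) (R⊆I i Ri)
      separate' {j} p (there e∈) | Rj , ne = far Rj (λ eq → ne (here eq)) e∈

    -- One node comes from the reached vertex of `I` and at least one from a connecting vertex.
    Extension : VSet n → ℕ → Set
    Extension R h = ∃ λ i → ∃₂ λ h' L' → Partial (R ∖ (i ∷ [])) h' L' × 2 + h ≤ h'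

    module Step {R h L} (P : Partial R h L) where
      open Partial P

      closed-nbhd : VSet n
      closed-nbhd v = elem v (map vertex L) ∨ touches G v (map vertex L)

      module _ {v z e₀} (v∉ : v ∉ map vertex L) (Xv : X v ≡ true) (e₀∈ : e₀ ∈ L) (ve₀ : adj G v (vertex e₀) ≡ true)
               (attached : ∀ {e} → e ∈ L → adj G v (vertex e) ≡ inc e z) where

        e₀z : inc e₀ z ≡ true
        e₀z = trans (sym (attached e₀∈)) ve₀

        z<h : z < h
        z<h with inc-ends e₀ e₀z
        ... | inj₁ refl = tail< G tree e₀∈
        ... | inj₂ refl = head< G tree e₀∈

        T' : LineTree G (suc h) (edge v z h ∷ L)
        T' = leaf tree v z z<h v∉ attached

        leaves' : LeavesIn I (_≢ h) (edge v z h ∷ L)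
        leaves' = leaves-∷ tree e₀∈ e₀z z<h (λ e∈ _ → leaves e∈ tt)

        v∉R : R v ≡ true → ⊥
        v∉R Rv = true≢false ve₀ (separate Rv e₀∈)

        fresh' : ∀ {j} → R j ≡ true → j ∉ v ∷ map vertex L
        fresh' Rj (here refl) = v∉R Rj
        fresh' Rj (there m) = fresh Rj m

        inX' : ∀ {e} → e ∈ edge v z h ∷ L → X (vertex e) ≡ true
        inX' (here refl) = Xv
        inX' (there e∈) = inX e∈

        -- One connecting vertex suffices. A second vertex of `R` next to `v` would give a claw
        -- centred at `v`, with a tree neighbour of `v` as third leaf.
        extend-near : ∀ {i} → R i ≡ true → adj G v i ≡ true → Extension R h
        extend-near {i} Ri vi = i , _ , _ ,
          grow-tip P tree z<h T' leaves' inX' (λ m → m) Ri (adj-sym G vi) (separate Ri) fresh' far , ≤-refl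
          where
          far : ∀ {j} → R j ≡ true → j ≢ i → ∀ {e} → e ∈ edge v z h ∷ L → adj G j (vertex e) ≡ false
          far Rj ne (there e∈) = separate Rj e∈
          far {j} Rj ne (here refl) with by-cases (adj G j v)
          ... | inj₂ p = p
          ... | inj₁ p = no-claw G claw-free (adj-sym G p) vi ve₀ ne
                (λ { refl → fresh Rj (∈-map⁺ vertex e₀∈) }) (λ { refl → fresh Ri (∈-map⁺ vertex e₀∈) })
                (I-independent _ _ (R⊆I j Rj) (R⊆I i Ri)) (separate Rj e₀∈) (separate Ri e₀∈)

        -- Two connecting vertices `v`, `u`. A second vertex of `R` next to `u` would give a claw
        -- centred at `u`, now with `v` as third leaf.
        extend-far : ∀ {u i} → X u ≡ true → adj G v u ≡ true → u ∉ map vertex L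
                   → (∀ {e} → e ∈ L → adj G u (vertex e) ≡ false) → (∀ {j} → R j ≡ true → adj G v j ≡ false)
                   → R i ≡ true → adj G u i ≡ true → Extension R h
        extend-far {u} {i} Xu vu u∉ u-far v-far Ri ui = i , _ , _ ,
          grow-tip P T' ≤-refl T'' (leaves-∷ T' (here refl) (inc-head (edge v z h) z<h) ≤-refl leaves')
            (λ { (here refl) → Xu ; (there e∈) → inX' e∈ }) there Ri (adj-sym G ui)
            (λ { (here refl) → adj-sym G (v-far Ri) ; (there e∈) → separate Ri e∈ })
            (λ { Rj (here refl) → true≢false vu (v-far Rj) ; Rj (there m) → fresh' Rj m })
            far , n≤1+n _
          where
          T'' : LineTree G (2 + h) (edge u h (suc h) ∷ edge v z h ∷ L)
          T'' = leaf T' u h ≤-refl (λ { (here refl) → true≢false vu (irref G u) ; (there m) → u∉ m })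
                  (attach-tip tree z<h (adj-sym G vu) u-far)
          far : ∀ {j} → R j ≡ true → j ≢ i → ∀ {e} → e ∈ edge u h (suc h) ∷ edge v z h ∷ L → adj G j (vertex e) ≡ false
          far Rj ne (there (here refl)) = adj-sym G (v-far Rj)
          far Rj ne (there (there e∈)) = separate Rj e∈
          far {j} Rj ne (here refl) with by-cases (adj G j u)
          ... | inj₂ p = p
          ... | inj₁ p = no-claw G claw-free (adj-sym G p) ui (adj-sym G vu) ne
                (λ { refl → v∉R Rj }) (λ { refl → v∉R Ri })
                (I-independent _ _ (R⊆I j Rj) (R⊆I i Ri)) (adj-sym G (v-far Rj)) (adj-sym G (v-far Ri))

      step : ∀ {i} → R i ≡ true → Extension R h
      -- The crossing edge runs from a vertex `v` just outside the tree to a vertex `u` with no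
      -- neighbour in the tree.
      step {i} Ri with connected closed-nbhd (inX (proj₂ first)) (I⊆X i (R⊆I i Ri))
                         (∨-introˡ (elem-complete (∈-map⁺ vertex (proj₂ first)))) (¬true⇒false i-outside)
        where
        i-outside : closed-nbhd i ≡ true → ⊥
        i-outside p with ∨-elim p
        ... | inj₁ q = fresh Ri (elem-sound _ q)
        ... | inj₂ q with touches-sound G i _ q
        ...   | w , m , r with ∈-map⁻ vertex m
        ...     | e , e∈ , refl = true≢false r (separate Ri e∈)
      ... | v , u , Xv , Xu , Pv , Pu , vu = finish
        where
        u∉ : u ∉ map vertex L
        u∉ m = true≢false (∨-introˡ (elem-complete m)) Pu
        u-far : ∀ {e} → e ∈ L → adj G u (vertex e) ≡ false
        u-far {e} e∈ = ¬true⇒false λ p → true≢false (∨-introʳ {elem u (map vertex L)} (touches-complete G (∈-map⁺ vertex e∈) p)) Pu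
        v∉ : v ∉ map vertex L
        v∉ m with ∈-map⁻ vertex m
        ... | e , e∈ , refl = true≢false (adj-sym G vu) (u-far e∈)
        neighbour : ∃ λ e → e ∈ L × adj G v (vertex e) ≡ true
        neighbour with ∨-elim Pv
        ... | inj₁ q = ⊥-elim (v∉ (elem-sound _ q))
        ... | inj₂ q with touches-sound G v _ q
        ...   | w , m , r with ∈-map⁻ vertex m
        ...     | e , e∈ , refl = e , e∈ , r
        attach : ∀ w → w ∉ map vertex L → adj G v w ≡ true → (∀ {e} → e ∈ L → adj G w (vertex e) ≡ false)
               → ∃ λ z → ∀ {e} → e ∈ L → adj G v (vertex e) ≡ inc e z
        attach w w∉ vw w-far = Attach.attached G claw-free tree I I-independent
          (λ e∈ → leaves e∈ tt) v w v∉ w∉ vw w-far (proj₁ (proj₂ neighbour)) (proj₂ (proj₂ neighbour))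
        finish : Extension R h
        finish with #-witness (λ j → R j ∧ adj G v j)
        ... | inj₁ (j , p) with ∧-elim p
        ...   | Rj , vj with attach j (fresh Rj) vj (separate Rj) | neighbour
        ...     | z , att | e₀ , e₀∈ , ve₀ = extend-near v∉ Xv e₀∈ ve₀ att Rj vj
        finish | inj₂ none with attach u u∉ vu u-far | neighbour | by-cases (I u)
        ... | z , att | e₀ , e₀∈ , ve₀ | Iu = go Iu
          where
          v-far : ∀ {j} → R j ≡ true → adj G v j ≡ false
          v-far {j} Rj = ¬true⇒false λ p → <⇒≢ (#-pos {f = λ j → R j ∧ adj G v j} (∧-intro Rj p)) (sym none)
          I-near : ∀ {j} → I j ≡ true → j ∉ map vertex L → R j ≡ true
          I-near {j} Ij j∉ with cover j Ij
          ... | inj₁ m = ⊥-elim (j∉ m)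
          ... | inj₂ Rj = Rj
          go : I u ≡ true ⊎ I u ≡ false → Extension R h
          -- A vertex `u` of `I` outside the tree would be a neighbour of `v` in `R`, and there is
          -- none. Otherwise `u` has a neighbour in `I`, which is outside the tree since `u` is far
          -- from it.
          go (inj₁ Iu) = true≢false vu (v-far (I-near Iu u∉))
          go (inj₂ Iu) with dominating u Xu Iu
          ... | j , Ij , uj = extend-far v∉ Xv e₀∈ ve₀ att Xu vu u∉ u-far v-far (I-near Ij j∉) uj
            where
            j∉ : j ∉ map vertex L
            j∉ m with ∈-map⁻ vertex m
            ... | e , e∈ , refl = true≢false uj (u-far e∈)

    grow : ∀ r {R h L} → Partial R h L → r ≤ # R
         → ∃₂ λ h' L' → LineTree G h' L' × (∀ {e} → e ∈ L' → X (vertex e) ≡ true) × h + 2 * r ≤ h'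
    grow zero {h = h} P _ = _ , _ , Partial.tree P , Partial.inX P , ≤-reflexive (+-identityʳ h)
    grow (suc r) {R} {h} P le with #-witness R
    ... | inj₂ none = ⊥-elim (<-irrefl refl (≤-trans (s≤s z≤n) (≤-trans le (≤-reflexive none))))
    ... | inj₁ (i₀ , Ri₀) with Step.step P Ri₀
    ...   | i , h₁ , L₁ , P₁ , le₁ with grow r P₁ (≤-pred (≤-trans le (#-∖ R (i ∷ []))))
    ...     | h' , L' , T , inX , le' = h' , L' , T , inX ,
              ≤-trans (≤-reflexive arith) (≤-trans (ℕₚ.+-monoˡ-≤ (2 * r) le₁) le')
      where
      arith : h + 2 * suc r ≡ 2 + h + 2 * r
      arith = trans (cong (h +_) (ℕₚ.*-suc 2 r)) (trans (sym (ℕₚ.+-assoc h 2 (2 * r))) (cong (_+ 2 * r) (ℕₚ.+-comm h 2)))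

    start : ∀ {i} → I i ≡ true → Partial (I ∖ (i ∷ [])) 2 (edge i 0 1 ∷ [])
    start {i} Ii = record
      { tree = leaf root i 0 (s≤s z≤n) (λ ()) (λ ())
      ; first = _ , here refl
      ; inX = λ { (here refl) → I⊆X i Ii }
      ; cover = cover'
      ; R⊆I = λ j p → proj₁ (∖-∈ I (i ∷ []) p)
      ; fresh = λ p → λ { (here eq) → proj₂ (∖-∈ I (i ∷ []) p) (here eq) }
      ; separate = λ { {j} p (here refl) → I-independent _ _ (proj₁ (∖-∈ I (i ∷ []) p)) Ii }
      ; leaves = λ { (here refl) _ _ _ → Ii } }
      where
      cover' : ∀ j → I j ≡ true → j ∈ i ∷ [] ⊎ (I ∖ (i ∷ [])) j ≡ true
      cover' j Ij with j ≟ i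
      ... | yes refl = inj₁ (here refl)
      ... | no ne = inj₂ (∧-intro Ij refl)

    independent⇒odd : ∀ m → 2 * m ≤ # I → ∃ λ S → Odd G S × (∀ {v} → v ∈ S → X v ≡ true) × 2 * m ≤ length S
    independent⇒odd zero _ = [] , mkOdd [] (λ ()) , (λ ()) , z≤n
    independent⇒odd m@(suc _) le with #-witness I
    ... | inj₂ none = ⊥-elim (<-irrefl refl (≤-trans (s≤s z≤n) (≤-trans le (≤-reflexive none))))
    ... | inj₁ (i , Ii) with # I in eq
    ...   | suc r with grow r (start Ii) (≤-pred (≤-trans (≤-reflexive (sym eq)) (#-∖ I (i ∷ []))))
    ...     | h , L , T , inX , le' with LineTree-odd G T m (≤-trans arith le')
      where
      -- `2 + 2 * r` is twice the size `suc r` of `I`: two nodes at the start and two for each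
      -- further vertex.
      arith : 4 * m ≤ 2 + 2 * r
      arith = ≤-trans (≤-reflexive (ℕₚ.*-assoc 2 2 m)) (≤-trans (ℕₚ.*-monoʳ-≤ 2 le) (≤-reflexive (ℕₚ.*-suc 2 r)))
    ...       | S , o , inL , long = S , o , inX' , long
      where
      inX' : ∀ {v} → v ∈ S → X v ≡ true
      inX' p with ∈-map⁻ vertex (inL p)
      ... | e , e∈ , refl = inX e∈

-- Induced matchings

find : ∀ {n} (f : VSet n) → (∃ λ v → f v ≡ true) ⊎ (∀ v → f v ≡ false)
find f with #-witness f
... | inj₁ p = inj₁ p
... | inj₂ none = inj₂ λ v → ¬true⇒false λ p → ℕₚ.<⇒≢ (#-pos {f = f} p) (sym none)

#-∖-< : ∀ {n} (f : VSet n) xs {u} → f u ≡ true → u ∈ xs → # (f ∖ xs) < # f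
#-∖-< f xs {u} fu u∈ = ≤-trans (≤-trans (≤-reflexive (ℕₚ.+-comm 1 _)) (ℕₚ.+-monoʳ-≤ (# (f ∖ xs)) (#-pos {f = _== u} {u} (==-refl u))))
  (#-disjoint {f = f ∖ xs} {_== u} {f} (λ v p → proj₁ (∖-∈ f xs p)) (λ v p → subst (λ w → f w ≡ true) (sym (==-sound p)) fu)
    (λ v p q → proj₂ (∖-∈ f xs p) (subst (_∈ xs) (sym (==-sound q)) u∈)))

module _ {n : ℕ} (G : Graph n) where

  Bipartite : VSet n → VSet n → Set
  Bipartite χ Y = ∀ {u v} → Y u ≡ true → Y v ≡ true → adj G u v ≡ true → χ u ≡ not (χ v)

  NoIsolated : VSet n → Set
  NoIsolated Y = ∀ {v} → Y v ≡ true → ∃ λ u → Y u ≡ true × adj G v u ≡ true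

  Isolated : VSet n → Fin n → Set
  Isolated Y v = ∀ u → Y u ≡ true → adj G v u ≡ false

  isolated? : ∀ Y v → Isolated Y v ⊎ (∃ λ u → Y u ≡ true × adj G v u ≡ true)
  isolated? Y v with find (λ u → Y u ∧ adj G v u)
  ... | inj₁ (u , p) = inj₂ (u , ∧-elim p)
  ... | inj₂ none = inj₁ λ u Yu → ¬true⇒false λ p → true≢false (∧-intro Yu p) (none u)

  anyIsolated? : ∀ Y → (∃ λ v → Y v ≡ true × Isolated Y v) ⊎ NoIsolated Y
  anyIsolated? Y with any? (λ v → (Y v Boolₚ.≟ true) ×-dec all? (λ u → (Y u Boolₚ.≟ true) →-dec (adj G v u Boolₚ.≟ false)))
  ... | yes p = inj₁ p
  ... | no none = inj₂ λ {v} Yv → [ (λ iso → ⊥-elim (none (v , Yv , iso))) , (λ p → p) ]′ (isolated? Y v)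

  another : ∀ (Y : VSet n) u v → (∃ λ z → Y z ≡ true × adj G u z ≡ true × z ≢ v) ⊎ (∀ {z} → Y z ≡ true → adj G u z ≡ true → z ≡ v)
  another Y u v with find (λ z → Y z ∧ adj G u z ∧ not (z == v))
  ... | inj₁ (z , p) with ∧-elim p
  ...   | Yz , q with ∧-elim q
  ...     | uz , r = inj₁ (z , Yz , uz , λ { refl → true≢false (==-refl z) (not-elim r) })
  another Y u v | inj₂ none = inj₂ only
    where
    only : ∀ {z} → Y z ≡ true → adj G u z ≡ true → z ≡ v
    only {z} Yz uz with z ≟ v | none z
    ... | yes eq | _ = eq
    ... | no ne | q = true≢false (∧-intro Yz (∧-intro uz refl)) q

  pair-odd : ∀ {u v} → adj G u v ≡ true → Odd G (u ∷ v ∷ [])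
  pair-odd {u} {v} uv = mkOdd ((adj⇒≢ G uv ∷ []) ∷ [] ∷ []) λ
    { (here refl) → cong₂ _xor_ (irref G u) (cong (_xor false) uv)
    ; (there (here refl)) → cong₂ _xor_ (adj-sym G uv) (cong (_xor false) (irref G v)) }

  module Matching (claw-free : ClawFree G) (χ : VSet n) where

    same-colour : ∀ {Y u v} → Bipartite χ Y → Y u ≡ true → Y v ≡ true → χ u ≡ χ v → adj G u v ≡ false
    same-colour {u = u} {v} bip Yu Yv eq = ¬true⇒false λ p → not-fixed (χ v) (trans (sym eq) (bip Yu Yv p))
      where
      not-fixed : ∀ b → b ≡ not b → ⊥
      not-fixed true ()
      not-fixed false ()

    opposite : ∀ {Y u v w} → Bipartite χ Y → Y u ≡ true → Y v ≡ true → Y w ≡ true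
             → adj G u v ≡ true → adj G u w ≡ true → χ v ≡ χ w
    opposite bip Yu Yv Yw uv uw = trans (bip Yv Yu (adj-sym G uv)) (sym (bip Yw Yu (adj-sym G uw)))

    -- Neighbours of `c` in `Y` have the same colour, so three of them would be the leaves of a
    -- claw. Hence the components of `Y` are paths and cycles.
    two-neighbours : ∀ {Y c a b z} → Bipartite χ Y → Y c ≡ true → Y a ≡ true → Y b ≡ true → Y z ≡ true
                   → adj G c a ≡ true → adj G c b ≡ true → a ≢ b → adj G c z ≡ true → z ≡ a ⊎ z ≡ b
    two-neighbours {Y} {c} {a} {b} {z} bip Yc Ya Yb Yz ca cb a≢b cz with z ≟ a | z ≟ b
    ... | yes eq | _ = inj₁ eq
    ... | no _ | yes eq = inj₂ eq
    ... | no z≢a | no z≢b = no-claw G claw-free cz ca cb z≢a z≢b a≢b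
          (same Yz Ya (opposite bip Yc Yz Ya cz ca)) (same Yz Yb (opposite bip Yc Yz Yb cz cb)) (same Ya Yb (opposite bip Yc Ya Yb ca cb))
      where
      same : ∀ {u v} → Y u ≡ true → Y v ≡ true → χ u ≡ χ v → adj G u v ≡ false
      same = same-colour bip

    -- The deleted list contains all neighbours of `u` and `v`, so the edge uv stays apart from
    -- later choices; `rest` allows the removal to be repeated. Repetitions pad the list to four
    -- entries.
    record Removable (Y : VSet n) : Set where
      field
        u v a b : Fin n
        Yu : Y u ≡ true
        Yv : Y v ≡ true
        uv : adj G u v ≡ true
        near-u : ∀ {z} → Y z ≡ true → adj G u z ≡ true → z ∈ u ∷ v ∷ a ∷ b ∷ []
        near-v : ∀ {z} → Y z ≡ true → adj G v z ≡ true → z ∈ u ∷ v ∷ a ∷ b ∷ []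
        rest : NoIsolated (Y ∖ (u ∷ v ∷ a ∷ b ∷ []))

    module _ {Y : VSet n} (bip : Bipartite χ Y) (noIso : NoIsolated Y) where

      -- Every vertex has some neighbour; only vertices whose chosen neighbour was deleted need
      -- another one.
      remainder : ∀ {xs} → (∀ {z y} → Y z ≡ true → z ∉ xs → Y y ≡ true → adj G z y ≡ true → y ∈ xs
                            → ∃ λ y' → Y y' ≡ true × adj G z y' ≡ true × y' ∉ xs)
                → NoIsolated (Y ∖ xs)
      remainder {xs} rescue {z} p with ∖-∈ Y xs p
      ... | Yz , z∉ with noIso Yz
      ...   | y , Yy , zy with by-cases (elem y xs)
      ...     | inj₂ y∉ = y , ∧-intro Yy (not-intro y∉) , zy
      ...     | inj₁ y∈ with rescue Yz z∉ Yy zy (elem-sound xs y∈)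
      ...       | y' , Yy' , zy' , y'∉ = y' , ∖-intro Y xs Yy' y'∉ , zy'

      -- The component is a path u, v, w, x, ... with end `u`. Deleting `u`, `v`, `w` leaves no
      -- isolated vertex unless the path stops at `x`, and then `x` is deleted too. Shorter paths
      -- are deleted whole.
      remove-at-end : ∀ {u v} → Y u ≡ true → Y v ≡ true → adj G u v ≡ true
                    → (∀ {z} → Y z ≡ true → adj G u z ≡ true → z ≡ v) → Removable Y
      remove-at-end {u} {v} Yu Yv uv only-v with another Y v u
      ... | inj₂ only-u = record
        { u = u ; v = v ; a = u ; b = u ; Yu = Yu ; Yv = Yv ; uv = uv
        ; near-u = λ Yz uz → there (here (only-v Yz uz)) ; near-v = λ Yz vz → here (only-u Yz vz)
        ; rest = remainder {u ∷ v ∷ u ∷ u ∷ []} λ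
          { Yz z∉ Yy zy (here refl) → ⊥-elim (z∉ (there (here (only-v Yz (adj-sym G zy)))))
          ; Yz z∉ Yy zy (there (here refl)) → ⊥-elim (z∉ (here (only-u Yz (adj-sym G zy))))
          ; Yz z∉ Yy zy (there (there (here refl))) → ⊥-elim (z∉ (there (here (only-v Yz (adj-sym G zy)))))
          ; Yz z∉ Yy zy (there (there (there (here refl)))) → ⊥-elim (z∉ (there (here (only-v Yz (adj-sym G zy))))) } }
      ... | inj₁ (w , Yw , vw , w≢u) = at-w (another Y w v)
        where
        near-v' : ∀ {b z} → Y z ≡ true → adj G v z ≡ true → z ∈ u ∷ v ∷ w ∷ b ∷ []
        near-v' Yz vz with two-neighbours bip Yv Yu Yw Yz (adj-sym G uv) vw (w≢u ∘ sym) vz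
        ... | inj₁ eq = here eq
        ... | inj₂ eq = there (there (here eq))
        mk : ∀ b → NoIsolated (Y ∖ (u ∷ v ∷ w ∷ b ∷ [])) → Removable Y
        mk b rest = record
          { u = u ; v = v ; a = w ; b = b ; Yu = Yu ; Yv = Yv ; uv = uv
          ; near-u = λ Yz uz → there (here (only-v Yz uz)) ; near-v = near-v' ; rest = rest }
        mk' : ∀ b → (∀ {z y} → Y z ≡ true → z ∉ u ∷ v ∷ w ∷ b ∷ [] → Y y ≡ true → adj G z y ≡ true → y ∈ w ∷ b ∷ []
                     → ∃ λ y' → Y y' ≡ true × adj G z y' ≡ true × y' ∉ u ∷ v ∷ w ∷ b ∷ []) → Removable Y
        mk' b rescue = mk b (remainder λ
          { Yz z∉ Yy zy (here refl) → ⊥-elim (z∉ (there (here (only-v Yz (adj-sym G zy)))))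
          ; Yz z∉ Yy zy (there (here refl)) → ⊥-elim (z∉ (near-v' Yz (adj-sym G zy)))
          ; Yz z∉ Yy zy (there (there y∈)) → rescue Yz z∉ Yy zy y∈ })
        at-w : (∃ λ z → Y z ≡ true × adj G w z ≡ true × z ≢ v) ⊎ (∀ {z} → Y z ≡ true → adj G w z ≡ true → z ≡ v) → Removable Y
        at-w (inj₂ only-v') = mk' u λ
          { Yz z∉ Yy zy (here refl) → ⊥-elim (z∉ (there (here (only-v' Yz (adj-sym G zy)))))
          ; Yz z∉ Yy zy (there (here refl)) → ⊥-elim (z∉ (there (here (only-v Yz (adj-sym G zy))))) }
        at-w (inj₁ (x , Yx , wx , x≢v)) with another Y x w
        ... | inj₂ only-w = mk' x λ
          { Yz z∉ Yy zy (here refl) → ⊥-elim (z∉ ([ (λ { refl → there (here refl) }) , (λ { refl → there (there (there (here refl))) }) ]′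
                (two-neighbours bip Yw Yv Yx Yz (adj-sym G vw) wx (x≢v ∘ sym) (adj-sym G zy))))
          ; Yz z∉ Yy zy (there (here refl)) → ⊥-elim (z∉ (there (there (here (only-w Yz (adj-sym G zy)))))) }
        ... | inj₁ (x' , Yx' , xx' , x'≢w) = mk' u λ
          { Yz z∉ Yy zy (here refl) → [ (λ { refl → ⊥-elim (z∉ (there (here refl))) }) , (λ { refl → x' , Yx' , xx' , x'∉ }) ]′
                (two-neighbours bip Yw Yv Yx Yz (adj-sym G vw) wx (x≢v ∘ sym) (adj-sym G zy))
          ; Yz z∉ Yy zy (there (here refl)) → ⊥-elim (z∉ (there (here (only-v Yz (adj-sym G zy))))) }
          where
          x'≢u : x' ≢ u
          x'≢u refl = x≢v (only-v Yx (adj-sym G xx'))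
          x'≢v : x' ≢ v
          x'≢v refl with two-neighbours bip Yv Yu Yw Yx (adj-sym G uv) vw (w≢u ∘ sym) (adj-sym G xx')
          ... | inj₁ refl = adj⇒≢ G vw (sym (only-v Yw (adj-sym G wx)))
          ... | inj₂ refl = adj⇒≢ G wx refl
          x'∉ : x' ∉ u ∷ v ∷ w ∷ u ∷ []
          x'∉ (here eq) = x'≢u eq
          x'∉ (there (here eq)) = x'≢v eq
          x'∉ (there (there (here eq))) = x'≢w eq
          x'∉ (there (there (there (here eq)))) = x'≢u eq

      -- Without vertices of degree 1 all components are cycles, and any edge may be taken together
      -- with its two outer neighbours. A vertex stranded by this would be adjacent to both outer
      -- neighbours.
      remove-anywhere : (∀ {u v} → Y u ≡ true → Y v ≡ true → adj G u v ≡ true → ∃ λ z → Y z ≡ true × adj G u z ≡ true × z ≢ v)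
                      → ∀ {u v} → Y u ≡ true → Y v ≡ true → adj G u v ≡ true → Removable Y
      remove-anywhere second {u} {v} Yu Yv uv with second Yu Yv uv | second Yv Yu (adj-sym G uv)
      ... | u' , Yu' , uu' , u'≢v | v' , Yv' , vv' , v'≢u = record
        { u = u ; v = v ; a = u' ; b = v' ; Yu = Yu ; Yv = Yv ; uv = uv ; near-u = near-u ; near-v = near-v
        ; rest = remainder λ
          { Yz z∉ Yy zy (here refl) → ⊥-elim (z∉ (near-u Yz (adj-sym G zy)))
          ; Yz z∉ Yy zy (there (here refl)) → ⊥-elim (z∉ (near-v Yz (adj-sym G zy)))
          ; Yz z∉ Yy zy (there (there (here refl))) → rescue-u' Yz z∉ zy
          ; Yz z∉ Yy zy (there (there (there (here refl)))) → rescue-v' Yz z∉ zy } }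
        where
        xs = u ∷ v ∷ u' ∷ v' ∷ []
        near-u : ∀ {z} → Y z ≡ true → adj G u z ≡ true → z ∈ xs
        near-u Yz uz with two-neighbours bip Yu Yv Yu' Yz uv uu' (u'≢v ∘ sym) uz
        ... | inj₁ eq = there (here eq)
        ... | inj₂ eq = there (there (here eq))
        near-v : ∀ {z} → Y z ≡ true → adj G v z ≡ true → z ∈ xs
        near-v Yz vz with two-neighbours bip Yv Yu Yv' Yz (adj-sym G uv) vv' (v'≢u ∘ sym) vz
        ... | inj₁ eq = here eq
        ... | inj₂ eq = there (there (there (here eq)))
        -- A common neighbour of u' and v' would close a 5-cycle.
        no-pentagon : ∀ {z} → Y z ≡ true → adj G z u' ≡ true → adj G z v' ≡ true → ⊥
        no-pentagon Yz zu' zv' = true≢false uv (same-colour bip Yu Yv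
          (trans (opposite bip Yu' Yu Yz (adj-sym G uu') (adj-sym G zu')) (opposite bip Yv' Yz Yv (adj-sym G zv') (adj-sym G vv'))))
        rescue-u' : ∀ {z} → Y z ≡ true → z ∉ xs → adj G z u' ≡ true → ∃ λ y → Y y ≡ true × adj G z y ≡ true × y ∉ xs
        rescue-u' Yz z∉ zu' with second Yz Yu' zu'
        ... | y , Yy , zy , y≢u' = y , Yy , zy , λ
          { (here refl) → z∉ (near-u Yz (adj-sym G zy)) ; (there (here refl)) → z∉ (near-v Yz (adj-sym G zy))
          ; (there (there (here eq))) → y≢u' eq ; (there (there (there (here refl)))) → no-pentagon Yz zu' zy }
        rescue-v' : ∀ {z} → Y z ≡ true → z ∉ xs → adj G z v' ≡ true → ∃ λ y → Y y ≡ true × adj G z y ≡ true × y ∉ xs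
        rescue-v' Yz z∉ zv' with second Yz Yv' zv'
        ... | y , Yy , zy , y≢v' = y , Yy , zy , λ
          { (here refl) → z∉ (near-u Yz (adj-sym G zy)) ; (there (here refl)) → z∉ (near-v Yz (adj-sym G zy))
          ; (there (there (here refl))) → no-pentagon Yz zy zv' ; (there (there (there (here eq)))) → y≢v' eq }

      removable : ∀ {u} → Y u ≡ true → Removable Y
      removable Yu₀ with any? (λ u → any? (λ v → (Y u Boolₚ.≟ true) ×-dec (Y v Boolₚ.≟ true) ×-dec (adj G u v Boolₚ.≟ true)
                               ×-dec all? (λ z → (Y z Boolₚ.≟ true) →-dec ((adj G u z Boolₚ.≟ true) →-dec (z ≟ v)))))
      ... | yes (u , v , Yu , Yv , uv , only) = remove-at-end Yu Yv uv (λ {z} → only z)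
      ... | no none with noIso Yu₀
      ...   | v₀ , Yv₀ , uv₀ = remove-anywhere second Yu₀ Yv₀ uv₀
        where
        second : ∀ {u v} → Y u ≡ true → Y v ≡ true → adj G u v ≡ true → ∃ λ z → Y z ≡ true × adj G u z ≡ true × z ≢ v
        second {u} {v} Yu Yv uv with another Y u v
        ... | inj₁ p = p
        ... | inj₂ only = ⊥-elim (none (u , v , Yu , Yv , uv , λ z → only))

    -- Each round spends at most four vertices of `Y` on two vertices of `S`, whence the factor 2.
    -- `N` bounds the recursion.
    matching : ∀ N (Y : VSet n) → # Y ≤ N → Bipartite χ Y → NoIsolated Y
             → ∃ λ S → Odd G S × (∀ {v} → v ∈ S → Y v ≡ true) × # Y ≤ 2 * length S
    matching zero Y le bip noIso = [] , mkOdd [] (λ ()) , (λ ()) , le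
    matching (suc N) Y le bip noIso with #-witness Y
    ... | inj₂ none = [] , mkOdd [] (λ ()) , (λ ()) , ≤-reflexive none
    ... | inj₁ (u₀ , Yu₀) = go (removable bip noIso Yu₀)
      where
      go : Removable Y → ∃ λ S → Odd G S × (∀ {v} → v ∈ S → Y v ≡ true) × # Y ≤ 2 * length S
      go R with matching N (Y ∖ xs) (≤-pred (≤-trans (#-∖-< Y xs Yu (here refl)) le))
                  (λ p q → bip (proj₁ (∖-∈ Y xs p)) (proj₁ (∖-∈ Y xs q))) rest
        where
        open Removable R
        xs = u ∷ v ∷ a ∷ b ∷ []
      ... | S , o , S⊆ , long = u ∷ v ∷ S , Odd-++ G (pair-odd uv) o sep , inY ,
              ≤-trans (#-∖ Y xs) (≤-trans (ℕₚ.+-monoʳ-≤ 4 long) (≤-reflexive (sym (ℕₚ.*-distribˡ-+ 2 2 (length S)))))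
        where
        open Removable R
        xs = u ∷ v ∷ a ∷ b ∷ []
        inY : ∀ {w} → w ∈ u ∷ v ∷ S → Y w ≡ true
        inY (here refl) = Yu
        inY (there (here refl)) = Yv
        inY (there (there m)) = proj₁ (∖-∈ Y xs (S⊆ m))
        sep : ∀ {y w} → y ∈ u ∷ v ∷ [] → w ∈ S → y ≢ w × adj G y w ≡ false
        sep y∈ w∈ with ∖-∈ Y xs (S⊆ w∈)
        sep (here refl) w∈ | Yw , w∉ = (λ { refl → w∉ (here refl) }) , ¬true⇒false (w∉ ∘ near-u Yw)
        sep (there (here refl)) w∈ | Yw , w∉ = (λ { refl → w∉ (there (here refl)) }) , ¬true⇒false (w∉ ∘ near-v Yw)

-- Two large colour classes

insert : ∀ {n} → Fin n → VSet n → VSet n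
insert v K u = (u == v) ∨ K u

insert-∈ : ∀ {n} (K : VSet n) v u → insert v K u ≡ true → u ≡ v ⊎ K u ≡ true
insert-∈ K v u p with u ≟ v
... | yes eq = inj₁ eq
... | no _ = inj₂ p

#-insert-∉ : ∀ {n} (K : VSet n) {v} → K v ≡ false → # (insert v K) ≡ suc (# K)
#-insert-∉ K {v} Kv = #-insert {f = K} v Kv (∨-introˡ (==-refl v)) (λ u ne → cong (_∨ K u) (sym (==-false ne)))

module _ {n : ℕ} (G : Graph n) where

  Independent-insert : ∀ {K v} → Independent G K → (∀ {u} → K u ≡ true → adj G v u ≡ false) → Independent G (insert v K)
  Independent-insert {K} {v} ind far u w p q with insert-∈ K v u p | insert-∈ K v w q
  ... | inj₂ Ku | inj₂ Kw = ind u w Ku Kw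
  ... | inj₁ refl | inj₂ Kw = far Kw
  ... | inj₂ Ku | inj₁ refl = adj-sym G (far Ku)
  ... | inj₁ refl | inj₁ refl = irref G v

  -- The net: the triangle `x`, `i`, `j` has degrees 3, and its pendant vertices `v`, `k`, `l` have
  -- degree 1.
  net-odd : ∀ {v x i j k l} → adj G v x ≡ true → adj G x i ≡ true → adj G x j ≡ true → adj G i j ≡ true
          → adj G i k ≡ true → adj G j l ≡ true
          → adj G v i ≡ false → adj G v j ≡ false → adj G v k ≡ false → adj G v l ≡ false
          → adj G x k ≡ false → adj G x l ≡ false → adj G i l ≡ false → adj G j k ≡ false → adj G k l ≡ false
          → Odd G (v ∷ x ∷ i ∷ j ∷ k ∷ l ∷ [])
  net-odd {v} {x} {i} {j} {k} {l} vx xi xj ij ik jl vi vj vk vl xk xl il jk kl = mkOdd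
    ((adj⇒≢ G vx ∷ ≢-sym (differ ij vj) ∷ ≢-sym (differ (s ij) vi) ∷ ≢-sym (differ (s ik) vi) ∷ ≢-sym (differ (s jl) vj) ∷ [])
     ∷ (adj⇒≢ G xi ∷ adj⇒≢ G xj ∷ differ (s vx) (s vk) ∷ differ (s vx) (s vl) ∷ [])
     ∷ (adj⇒≢ G ij ∷ adj⇒≢ G ik ∷ differ (s xi) (s xl) ∷ [])
     ∷ (differ (s xj) (s xk) ∷ adj⇒≢ G jl ∷ [])
     ∷ (differ (s ik) (s il) ∷ [])
     ∷ [] ∷ []) at
    where
    s : ∀ {a b c} → adj G a b ≡ c → adj G b a ≡ c
    s = adj-sym G
    differ : ∀ {a b c} → adj G a c ≡ true → adj G b c ≡ false → a ≢ b
    differ p q refl = true≢false p q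
    at : ∀ {y} → y ∈ v ∷ x ∷ i ∷ j ∷ k ∷ l ∷ [] → parity G y (v ∷ x ∷ i ∷ j ∷ k ∷ l ∷ []) ≡ true
    at (here refl) rewrite irref G v | vx | vi | vj | vk | vl = refl
    at (there (here refl)) rewrite s vx | irref G x | xi | xj | xk | xl = refl
    at (there (there (here refl))) rewrite s vi | s xi | irref G i | ij | ik | il = refl
    at (there (there (there (here refl)))) rewrite s vj | s xj | s ij | irref G j | jk | jl = refl
    at (there (there (there (there (here refl))))) rewrite s vk | s xk | s ik | s jk | irref G k | kl = refl
    at (there (there (there (there (there (here refl)))))) rewrite s vl | s xl | s il | s jl | s kl | irref G l = refl

  module TwoClasses (claw-free : ClawFree G) (no-isolated : NoIsolatedVertices G) (X I J : VSet n) (m : ℕ)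
    (X-closed : ∀ {u v} → X u ≡ true → adj G u v ≡ true → X v ≡ true)
    (I⊆X : I ⊆ X) (J⊆X : J ⊆ X) (I-independent : Independent G I) (J-independent : Independent G J)
    (disjoint : ∀ v → I v ≡ true → J v ≡ true → ⊥)
    (α-bound : ∀ K → K ⊆ X → Independent G K → # K ≤ suc (2 * m))
    (#I : suc (2 * m) ≤ # I) (#J : 2 * m ≤ # J) where

    open Matching G claw-free I

    Y : VSet n
    Y v = I v ∨ J v

    Y⊆X : Y ⊆ X
    Y⊆X v Yv = [ I⊆X v , J⊆X v ]′ (∨-elim Yv)

    IY : ∀ {v} → I v ≡ true → Y v ≡ true
    IY = ∨-introˡ

    JY : ∀ {v} → J v ≡ true → Y v ≡ true
    JY {v} = ∨-introʳ {I v}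

    beside-I : ∀ {u v} → I u ≡ true → Y v ≡ true → adj G u v ≡ true → J v ≡ true
    beside-I Iu Yv uv with ∨-elim Yv
    ... | inj₁ Iv = true≢false uv (I-independent _ _ Iu Iv)
    ... | inj₂ Jv = Jv

    beside-J : ∀ {u v} → J u ≡ true → Y v ≡ true → adj G u v ≡ true → I v ≡ true
    beside-J Ju Yv uv with ∨-elim Yv
    ... | inj₁ Iv = Iv
    ... | inj₂ Jv = true≢false uv (J-independent _ _ Ju Jv)

    bip : Bipartite G I Y
    bip {u} {v} Yu Yv uv with ∨-elim Yu
    ... | inj₁ Iu = trans Iu (sym (not-intro (¬true⇒false λ Iv → true≢false uv (I-independent _ _ Iu Iv))))
    ... | inj₂ Ju = trans (¬true⇒false λ Iu → disjoint u Iu Ju) (cong not (sym (beside-J Ju Yv uv)))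

    -- The excess over `4 * m` is decisive: half of `# Y`, rounded up, is `2 * m + 1`.
    #Y : suc (2 * (2 * m)) ≤ # Y
    #Y = ≤-trans (≤-reflexive (cong suc (cong (2 * m +_) (ℕₚ.+-identityʳ (2 * m)))))
           (≤-trans (ℕₚ.+-mono-≤ #I #J) (#-disjoint {f = I} {J} {Y} (λ _ → IY) (λ _ → JY) disjoint))

    Result : Set
    Result = ∃ λ S → Odd G S × (∀ {v} → v ∈ S → X v ≡ true) × suc (2 * m) ≤ length S

    restricted : ∀ xs → Bipartite G I (Y ∖ xs)
    restricted xs p q = bip (proj₁ (∖-∈ Y xs p)) (proj₁ (∖-∈ Y xs q))

    without-isolated : NoIsolated G Y → Result
    without-isolated noIso with matching (# Y) Y ≤-refl bip noIso
    ... | S , o , S⊆ , long = S , o , (λ p → Y⊆X _ (S⊆ p)) , ℕₚ.*-cancelˡ-< 2 (2 * m) (length S) (≤-trans #Y long)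

    -- A special odd set `S₀` pays for the deletion of `xs` at the same rate as the matching, two
    -- vertices of `Y` for each of its own.
    combine : ∀ {S₀} xs → Odd G S₀ → (∀ {v} → v ∈ S₀ → X v ≡ true) → length xs ≤ 2 * length S₀
            → (∀ {y w} → y ∈ S₀ → Y w ≡ true → w ∉ xs → y ≢ w × adj G y w ≡ false)
            → NoIsolated G (Y ∖ xs) → Result
    combine {S₀} xs o₀ S₀⊆X short sep noIso with matching (# (Y ∖ xs)) (Y ∖ xs) ≤-refl (restricted xs) noIso
    ... | S , o , S⊆ , long = S₀ ++ S
        , Odd-++ G o₀ o (λ y∈ w∈ → let (Yw , w∉) = ∖-∈ Y xs (S⊆ w∈) in sep y∈ Yw w∉)
        , (λ p → [ S₀⊆X , (λ w∈ → Y⊆X _ (proj₁ (∖-∈ Y xs (S⊆ w∈)))) ]′ (∈-++⁻ S₀ p))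
        , ℕₚ.*-cancelˡ-< 2 (2 * m) (length (S₀ ++ S))
            (≤-trans #Y (≤-trans (#-∖ Y xs) (≤-trans (ℕₚ.+-mono-≤ short long)
              (≤-reflexive (trans (sym (ℕₚ.*-distribˡ-+ 2 (length S₀) (length S))) (cong (2 *_) (sym (length-++ S₀))))))))

    -- An isolated vertex of `J` could be added to `I`, exceeding the independence bound.
    isolated∈I : ∀ {v} → Y v ≡ true → Isolated G Y v → I v ≡ true
    isolated∈I {v} Yv iso = [ (λ Iv → Iv) , (λ Jv → ⊥-elim (too-big (¬true⇒false λ Iv → disjoint v Iv Jv))) ]′ (∨-elim Yv)
      where
      too-big : I v ≡ false → ⊥
      too-big Iv = <-irrefl refl (≤-trans (s≤s #I) (≤-trans (≤-reflexive (sym (#-insert-∉ I Iv)))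
        (α-bound _ (λ u p → [ (λ { refl → Y⊆X v Yv }) , I⊆X u ]′ (insert-∈ I v u p))
          (Independent-insert I-independent (λ Iu → iso _ (IY Iu))))))

    -- Two isolated vertices, both in `I`, could be added to `J`, giving an independent set of at
    -- least `2 * m + 2` vertices.
    isolated-unique : ∀ {v w} → Y v ≡ true → Isolated G Y v → Y w ≡ true → Isolated G Y w → v ≡ w
    isolated-unique {v} {w} Yv iso-v Yw iso-w with v ≟ w
    ... | yes eq = eq
    ... | no v≢w = ⊥-elim (<-irrefl refl (≤-trans (s≤s (s≤s #J)) (≤-trans (≤-reflexive (sym size)) (α-bound K K⊆X K-independent))))
      where
      K₁ K : VSet n
      K₁ = insert v J
      K = insert w K₁
      J∌ : ∀ {u} → I u ≡ true → J u ≡ false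
      J∌ Iu = ¬true⇒false (disjoint _ Iu)
      size : # K ≡ suc (suc (# J))
      size = trans (#-insert-∉ K₁ (cong₂ _∨_ (==-false (v≢w ∘ sym)) (J∌ (isolated∈I Yw iso-w))))
                   (cong suc (#-insert-∉ J (J∌ (isolated∈I Yv iso-v))))
      K⊆X : K ⊆ X
      K⊆X u p with insert-∈ K₁ w u p
      ... | inj₁ refl = Y⊆X w Yw
      ... | inj₂ q with insert-∈ J v u q
      ...   | inj₁ refl = Y⊆X v Yv
      ...   | inj₂ Ju = J⊆X u Ju
      w-far : ∀ {u} → K₁ u ≡ true → adj G w u ≡ false
      w-far {u} q with insert-∈ J v u q
      ... | inj₁ refl = iso-w v Yv
      ... | inj₂ Ju = iso-w _ (JY Ju)
      K-independent : Independent G K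
      K-independent = Independent-insert (Independent-insert J-independent (λ Ju → iso-v _ (JY Ju))) w-far

    module WithIsolated {v x} (Yv : Y v ≡ true) (iso : Isolated G Y v) (vx : adj G v x ≡ true) where

      Iv : I v ≡ true
      Iv = isolated∈I Yv iso

      Xx : X x ≡ true
      Xx = X-closed (Y⊆X v Yv) vx

      x∉Y : ∀ {z} → Y z ≡ true → x ≢ z
      x∉Y Yz refl = true≢false vx (iso x Yz)

      noIso : ∀ {z} → Y z ≡ true → z ≢ v → ∃ λ y → Y y ≡ true × adj G z y ≡ true
      noIso {z} Yz z≢v = [ (λ iso-z → ⊥-elim (z≢v (isolated-unique Yz iso-z Yv iso))) , (λ p → p) ]′ (isolated? G Y z)

      -- Besides `v`, the vertex `x` sees at most one vertex of `I`: two of them and `v` would be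
      -- leaves of a claw centred at `x`. The same holds for `J`.
      x-in-I : ∀ {i z} → I i ≡ true → adj G x i ≡ true → i ≢ v → I z ≡ true → adj G x z ≡ true → z ≢ v → z ≡ i
      x-in-I {i} {z} Ii xi i≢v Iz xz z≢v with z ≟ i
      ... | yes eq = eq
      ... | no z≢i = no-claw G claw-free (adj-sym G vx) xi xz (i≢v ∘ sym) (z≢v ∘ sym) (z≢i ∘ sym)
                       (I-independent _ _ Iv Ii) (I-independent _ _ Iv Iz) (I-independent _ _ Ii Iz)

      J≢v : ∀ {z} → J z ≡ true → z ≢ v
      J≢v Jz refl = disjoint v Iv Jz

      x-in-J : ∀ {j z} → J j ≡ true → adj G x j ≡ true → J z ≡ true → adj G x z ≡ true → z ≡ j
      x-in-J {j} {z} Jj xj Jz xz with z ≟ j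
      ... | yes eq = eq
      ... | no z≢j = no-claw G claw-free (adj-sym G vx) xj xz (J≢v Jj ∘ sym) (J≢v Jz ∘ sym) (z≢j ∘ sym)
                       (iso _ (JY Jj)) (iso _ (JY Jz)) (J-independent _ _ Jj Jz)

      -- The edge vx has two vertices, so it pays for four deletions.
      with-edge : ∀ xs → length xs ≤ 4 → v ∈ xs → (∀ {z} → Y z ≡ true → adj G x z ≡ true → z ∈ xs) → NoIsolated G (Y ∖ xs) → Result
      with-edge xs short v∈ near = combine xs (pair-odd G vx) (λ { (here refl) → Y⊆X v Yv ; (there (here refl)) → Xx }) short λ
        { (here refl) Yw w∉ → (λ { refl → w∉ v∈ }) , iso _ Yw
        ; (there (here refl)) Yw w∉ → x∉Y Yw , ¬true⇒false (w∉ ∘ near Yw) }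

      -- Deleting `ys` strands at most one vertex, which becomes the fourth deletion. All its
      -- neighbours in `Y` were in `ys`, so its removal strands nothing further.
      remove-isolated : ∀ ys → length ys ≤ 3 → v ∈ ys → (∀ {z} → Y z ≡ true → adj G x z ≡ true → z ∈ ys)
                      → (∀ {z w} → Y z ≡ true → z ∉ ys → Isolated G (Y ∖ ys) z → Y w ≡ true → w ∉ ys → Isolated G (Y ∖ ys) w → w ≡ z)
                      → Result
      remove-isolated ys short v∈ near unique with anyIsolated? G (Y ∖ ys)
      ... | inj₂ ok = with-edge ys (≤-trans short (n≤1+n 3)) v∈ near ok
      ... | inj₁ (z , p , iso-z) with ∖-∈ Y ys p
      ...   | Yz , z∉ = with-edge (z ∷ ys) (s≤s short) (there v∈) (λ Yw xw → there (near Yw xw)) rest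
        where
        rest : NoIsolated G (Y ∖ (z ∷ ys))
        rest {w} q with ∖-∈ Y (z ∷ ys) q
        ... | Yw , w∉ with isolated? G (Y ∖ ys) w
        ...   | inj₁ iso-w = ⊥-elim (w∉ (here (unique Yz z∉ iso-z Yw (w∉ ∘ there) iso-w)))
        ...   | inj₂ (y , r , wy) with ∖-∈ Y ys r
        ...     | Yy , y∉ = y , ∖-intro Y (z ∷ ys) Yy (λ { (here refl) → true≢false (adj-sym G wy) (iso-z w (∖-intro Y ys Yw (w∉ ∘ there)))
                                                        ; (there m) → y∉ m }) , wy

      lost-neighbour : ∀ {ys z} → v ∈ ys → Y z ≡ true → z ∉ ys → Isolated G (Y ∖ ys) z → ∃ λ y → y ∈ ys × y ≢ v × adj G z y ≡ true
      lost-neighbour {ys} {z} v∈ Yz z∉ iso-z with noIso Yz (λ { refl → z∉ v∈ })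
      ... | y , Yy , zy with by-cases (elem y ys)
      ...   | inj₁ y∈ = y , elem-sound ys y∈ , (λ { refl → true≢false (adj-sym G zy) (iso z Yz) }) , zy
      ...   | inj₂ y∉ = true≢false zy (iso-z y (∧-intro Yy (not-intro y∉)))

      none : (∀ {z} → Y z ≡ true → adj G x z ≡ true → z ≡ v) → Result
      none only = remove-isolated (v ∷ []) (s≤s z≤n) (here refl) (λ Yz xz → here (only Yz xz)) unique
        where
        unique : ∀ {z w} → Y z ≡ true → z ∉ v ∷ [] → Isolated G (Y ∖ (v ∷ [])) z → Y w ≡ true → w ∉ v ∷ [] → Isolated G (Y ∖ (v ∷ [])) w → w ≡ z
        unique Yz z∉ iso-z _ _ _ with lost-neighbour (here refl) Yz z∉ iso-z
        ... | y , here eq , y≢v , _ = ⊥-elim (y≢v eq)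

      -- Here `i` may belong to either class. A stranded vertex has lost `i`; two such vertices and
      -- `x` would be leaves of a claw centred at `i`.
      one : ∀ {i} → Y i ≡ true → adj G x i ≡ true → (∀ {z} → Y z ≡ true → adj G x z ≡ true → z ∈ v ∷ i ∷ []) → Result
      one {i} Yi xi near = remove-isolated (v ∷ i ∷ []) (s≤s (s≤s z≤n)) (here refl) near unique
        where
        ys = v ∷ i ∷ []
        at-i : ∀ {z} → Y z ≡ true → z ∉ ys → Isolated G (Y ∖ ys) z → adj G i z ≡ true
        at-i Yz z∉ iso-z with lost-neighbour (here refl) Yz z∉ iso-z
        ... | y , here eq , y≢v , _ = ⊥-elim (y≢v eq)
        ... | y , there (here refl) , _ , zy = adj-sym G zy
        unique : ∀ {z w} → Y z ≡ true → z ∉ ys → Isolated G (Y ∖ ys) z → Y w ≡ true → w ∉ ys → Isolated G (Y ∖ ys) w → w ≡ z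
        unique {z} {w} Yz z∉ iso-z Yw w∉ iso-w with w ≟ z
        ... | yes eq = eq
        ... | no w≢z = no-claw G claw-free (adj-sym G xi) iz iw (x∉Y Yz) (x∉Y Yw) (w≢z ∘ sym)
              (¬true⇒false (z∉ ∘ near Yz)) (¬true⇒false (w∉ ∘ near Yw)) (same-colour bip Yz Yw (opposite bip Yi Yz Yw iz iw))
          where
          iz = at-i Yz z∉ iso-z
          iw = at-i Yw w∉ iso-w

      module Both {i j} (Ii : I i ≡ true) (i≢v : i ≢ v) (Jj : J j ≡ true) (xi : adj G x i ≡ true) (xj : adj G x j ≡ true) where

        ys : List (Fin n)
        ys = v ∷ i ∷ j ∷ []

        near : ∀ {z} → Y z ≡ true → adj G x z ≡ true → z ∈ ys
        near {z} Yz xz with z ≟ v | ∨-elim Yz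
        ... | yes eq | _ = here eq
        ... | no z≢v | inj₁ Iz = there (here (x-in-I Ii xi i≢v Iz xz z≢v))
        ... | no _ | inj₂ Jz = there (there (here (x-in-J Jj xj Jz xz)))

        -- Otherwise `v`, `i`, `j` would be leaves of a claw centred at `x`.
        ij : adj G i j ≡ true
        ij with by-cases (adj G i j)
        ... | inj₁ p = p
        ... | inj₂ p = no-claw G claw-free (adj-sym G vx) xi xj (i≢v ∘ sym) (J≢v Jj ∘ sym) (λ { refl → disjoint _ Ii Jj })
                         (I-independent _ _ Iv Ii) (iso _ (JY Jj)) p

        Lost : Fin n → Set
        Lost z = Y z ≡ true × z ∉ ys × Isolated G (Y ∖ ys) z

        beside : ∀ {z} → Lost z → adj G i z ≡ true ⊎ adj G j z ≡ true
        beside (Yz , z∉ , iso-z) with lost-neighbour (here refl) Yz z∉ iso-z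
        ... | y , here eq , y≢v , _ = ⊥-elim (y≢v eq)
        ... | y , there (here refl) , _ , zy = inj₁ (adj-sym G zy)
        ... | y , there (there (here refl)) , _ , zy = inj₂ (adj-sym G zy)

        -- In `Y` the vertex `i` has at most two neighbours, and one of them is `j`.
        unique-i : ∀ {z w} → Lost z → Lost w → adj G i z ≡ true → adj G i w ≡ true → w ≡ z
        unique-i (Yz , z∉ , _) (Yw , w∉ , _) iz iw with two-neighbours bip (IY Ii) (JY Jj) Yz Yw ij iz (λ eq → z∉ (there (there (here (sym eq))))) iw
        ... | inj₁ eq = ⊥-elim (w∉ (there (there (here eq))))
        ... | inj₂ eq = eq

        unique-j : ∀ {z w} → Lost z → Lost w → adj G j z ≡ true → adj G j w ≡ true → w ≡ z
        unique-j (Yz , z∉ , _) (Yw , w∉ , _) jz jw with two-neighbours bip (JY Jj) (IY Ii) Yz Yw (adj-sym G ij) jz (λ eq → z∉ (there (here (sym eq)))) jw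
        ... | inj₁ eq = ⊥-elim (w∉ (there (here eq)))
        ... | inj₂ eq = eq

        -- Both `i` and `j` strand a vertex, so five vertices must go, one too many for the edge vx.
        -- Together with `x` these five form an induced net, whose six vertices would pay for
        -- twelve.
        net : ∀ {k l} → Lost k → adj G i k ≡ true → Lost l → adj G j l ≡ true → Result
        net {k} {l} lk@(Yk , k∉ , iso-k) ik ll@(Yl , l∉ , iso-l) jl = combine xs
            (net-odd vx xi xj ij ik jl (I-independent _ _ Iv Ii) (iso _ (JY Jj)) (iso k Yk) (iso l Yl)
              (¬true⇒false (k∉ ∘ near Yk)) (¬true⇒false (l∉ ∘ near Yl))
              (I-independent _ _ Ii (beside-J Jj Yl jl)) (J-independent _ _ Jj (beside-I Ii Yk ik)) (iso-k l (∖-intro Y ys Yl l∉)))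
            (λ { (here refl) → Y⊆X v Yv ; (there (here refl)) → Xx ; (there (there (here refl))) → I⊆X i Ii
               ; (there (there (there (here refl)))) → J⊆X j Jj ; (there (there (there (there (here refl))))) → Y⊆X k Yk
               ; (there (there (there (there (there (here refl)))))) → Y⊆X l Yl })
            (s≤s (s≤s (s≤s (s≤s (s≤s z≤n))))) sep rest
          where
          xs = k ∷ l ∷ ys
          old : ∀ {w} → w ∉ xs → w ∉ ys
          old w∉ = w∉ ∘ there ∘ there
          sep : ∀ {y w} → y ∈ v ∷ x ∷ i ∷ j ∷ k ∷ l ∷ [] → Y w ≡ true → w ∉ xs → y ≢ w × adj G y w ≡ false
          sep (here refl) Yw w∉ = (λ { refl → old w∉ (here refl) }) , iso _ Yw
          sep (there (here refl)) Yw w∉ = x∉Y Yw , ¬true⇒false (old w∉ ∘ near Yw)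
          sep (there (there (here refl))) Yw w∉ = (λ { refl → old w∉ (there (here refl)) }) , ¬true⇒false λ iw →
            [ (λ eq → old w∉ (there (there (here eq)))) , (λ eq → w∉ (here eq)) ]′
              (two-neighbours bip (IY Ii) (JY Jj) Yk Yw ij ik (λ eq → k∉ (there (there (here (sym eq))))) iw)
          sep (there (there (there (here refl)))) Yw w∉ = (λ { refl → old w∉ (there (there (here refl))) }) , ¬true⇒false λ jw →
            [ (λ eq → old w∉ (there (here eq))) , (λ eq → w∉ (there (here eq))) ]′
              (two-neighbours bip (JY Jj) (IY Ii) Yl Yw (adj-sym G ij) jl (λ eq → l∉ (there (here (sym eq)))) jw)
          sep (there (there (there (there (here refl))))) Yw w∉ = (λ { refl → w∉ (here refl) }) , iso-k _ (∖-intro Y ys Yw (old w∉))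
          sep (there (there (there (there (there (here refl)))))) Yw w∉ = (λ { refl → w∉ (there (here refl)) }) , iso-l _ (∖-intro Y ys Yw (old w∉))
          rest : NoIsolated G (Y ∖ xs)
          rest {w} p with ∖-∈ Y xs p
          ... | Yw , w∉ with isolated? G (Y ∖ ys) w
          ...   | inj₁ iso-w = ⊥-elim ([ (λ iw → w∉ (here (unique-i lk lw ik iw))) , (λ jw → w∉ (there (here (unique-j ll lw jl jw)))) ]′ (beside lw))
            where lw = Yw , old w∉ , iso-w
          ...   | inj₂ (y , q , wy) with ∖-∈ Y ys q
          ...     | Yy , y∉ = y , ∖-intro Y xs Yy (λ
                    { (here refl) → true≢false (adj-sym G wy) (iso-k w (∖-intro Y ys Yw (old w∉)))
                    ; (there (here refl)) → true≢false (adj-sym G wy) (iso-l w (∖-intro Y ys Yw (old w∉)))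
                    ; (there (there r)) → y∉ r }) , wy

        lost? : ∀ c → (∃ λ z → Lost z × adj G c z ≡ true) ⊎ (∀ {z} → Lost z → adj G c z ≡ false)
        lost? c with any? (λ z → ((Y ∖ ys) z Boolₚ.≟ true) ×-dec (adj G c z Boolₚ.≟ true)
                              ×-dec all? (λ u → ((Y ∖ ys) u Boolₚ.≟ true) →-dec (adj G z u Boolₚ.≟ false)))
        ... | yes (z , p , cz , iso-z) = let (Yz , z∉) = ∖-∈ Y ys p in inj₁ (z , (Yz , z∉ , iso-z) , cz)
        ... | no no-lost = inj₂ λ (Yz , z∉ , iso-z) → ¬true⇒false λ cz → no-lost (_ , ∖-intro Y ys Yz z∉ , cz , iso-z)

        both : Result
        both with lost? i | lost? j
        ... | inj₁ (k , lk , ik) | inj₁ (l , ll , jl) = net lk ik ll jl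
        ... | inj₂ no-i | _ = remove-isolated ys ≤-refl (here refl) near λ Yz z∉ iso-z Yw w∉ iso-w →
              unique (Yz , z∉ , iso-z) (Yw , w∉ , iso-w)
          where
          at-j : ∀ {z} → Lost z → adj G j z ≡ true
          at-j lz = [ (λ iz → true≢false iz (no-i lz)) , (λ jz → jz) ]′ (beside lz)
          unique : ∀ {z w} → Lost z → Lost w → w ≡ z
          unique lz lw = unique-j lz lw (at-j lz) (at-j lw)
        ... | inj₁ _ | inj₂ no-j = remove-isolated ys ≤-refl (here refl) near λ Yz z∉ iso-z Yw w∉ iso-w →
              unique (Yz , z∉ , iso-z) (Yw , w∉ , iso-w)
          where
          at-i : ∀ {z} → Lost z → adj G i z ≡ true
          at-i lz = [ (λ iz → iz) , (λ jz → true≢false jz (no-j lz)) ]′ (beside lz)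
          unique : ∀ {z w} → Lost z → Lost w → w ≡ z
          unique lz lw = unique-i lz lw (at-i lz) (at-i lw)

      with-isolated : Result
      with-isolated with another G I x v | find (λ z → J z ∧ adj G x z)
      ... | inj₂ only-v | inj₂ no-J = none only
        where
        only : ∀ {z} → Y z ≡ true → adj G x z ≡ true → z ≡ v
        only {z} Yz xz with ∨-elim Yz
        ... | inj₁ Iz = only-v Iz xz
        ... | inj₂ Jz = true≢false (∧-intro Jz xz) (no-J z)
      ... | inj₁ (i , Ii , xi , i≢v) | inj₂ no-J = one (IY Ii) xi near
        where
        near : ∀ {z} → Y z ≡ true → adj G x z ≡ true → z ∈ v ∷ i ∷ []
        near {z} Yz xz with z ≟ v | ∨-elim Yz
        ... | yes eq | _ = here eq
        ... | no z≢v | inj₁ Iz = there (here (x-in-I Ii xi i≢v Iz xz z≢v))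
        ... | no _ | inj₂ Jz = true≢false (∧-intro Jz xz) (no-J z)
      ... | inj₂ only-v | inj₁ (j , p) = one (JY Jj) xj near
        where
        Jj = proj₁ (∧-elim {J j} p)
        xj = proj₂ (∧-elim {J j} p)
        near : ∀ {z} → Y z ≡ true → adj G x z ≡ true → z ∈ v ∷ j ∷ []
        near {z} Yz xz with ∨-elim Yz
        ... | inj₁ Iz = here (only-v Iz xz)
        ... | inj₂ Jz = there (here (x-in-J Jj xj Jz xz))
      ... | inj₁ (i , Ii , xi , i≢v) | inj₁ (j , p) = Both.both Ii i≢v (proj₁ (∧-elim {J j} p)) xi (proj₂ (∧-elim {J j} p))

    two-classes : Result
    two-classes with anyIsolated? G Y
    ... | inj₂ noIso = without-isolated noIso
    ... | inj₁ (v , Yv , iso) = WithIsolated.with-isolated Yv iso (proj₂ (no-isolated v))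

-- Assembling the components

-- A search through bit vectors finds a set only up to pointwise equality, so the property searched
-- for has to respect it.
Extensional : ∀ {n} → (VSet n → Set) → Set
Extensional P = ∀ {K K'} → (∀ v → K v ≡ K' v) → P K → P K'

anyVSet? : ∀ {n} {P : VSet n → Set} → Extensional P → (∀ K → Dec (P K)) → Dec (∃ P)
anyVSet? ext P? = map′ (λ (p , Pp) → lookup p , Pp) (λ (K , PK) → tabulate K , ext (λ v → sym (lookup∘tabulate K v)) PK)
  (anySubset? (λ p → P? (lookup p)))

-- The bound `d` is lowered until it is attained.
largest : ∀ {n} {P : VSet n → Set} → Extensional P → (∀ K → Dec (P K)) → ∃ P
        → ∀ d → (∀ K → P K → # K ≤ d) → ∃ λ K → P K × (∀ K' → P K' → # K' ≤ # K)
largest {P = P} ext P? (K₀ , PK₀) d bound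
  with anyVSet? {P = λ K → P K × # K ≡ d} (λ eq (PK , size) → ext eq PK , trans (sym (#-cong eq)) size) (λ K → P? K ×-dec (# K ℕₚ.≟ d))
... | yes (K , PK , size) = K , PK , λ K' PK' → ≤-trans (bound K' PK') (≤-reflexive (sym size))
... | no none with d
...   | zero = ⊥-elim (none (K₀ , PK₀ , ℕₚ.n≤0⇒n≡0 (bound K₀ PK₀)))
...   | suc d' = largest ext P? (K₀ , PK₀) d' λ K PK → ≤-pred (ℕₚ.≤∧≢⇒< (bound K PK) (λ size → none (K , PK , size)))

∑ : ∀ {k} → (Fin k → ℕ) → ℕ
∑ {zero} f = 0
∑ {suc k} f = f zero + ∑ (f ∘ suc)

∑-mono : ∀ {k} {f g : Fin k → ℕ} → (∀ c → f c ≤ g c) → ∑ f ≤ ∑ g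
∑-mono {zero} p = z≤n
∑-mono {suc k} p = ℕₚ.+-mono-≤ (p zero) (∑-mono (p ∘ suc))

∑-const : ∀ k M → ∑ {k} (λ _ → M) ≡ k * M
∑-const zero M = refl
∑-const (suc k) M = cong (M +_) (∑-const k M)

∑-+ : ∀ {k} (f g : Fin k → ℕ) → ∑ (λ c → f c + g c) ≡ ∑ f + ∑ g
∑-+ {zero} f g = refl
∑-+ {suc k} f g = trans (cong (f zero + g zero +_) (∑-+ (f ∘ suc) (g ∘ suc))) (+-interchange (f zero) (g zero) _ _)

#-single : ∀ {n} (a : Fin n) → # (a ==_) ≡ 1
#-single {n} a = trans (#-insert {f = λ _ → false} a refl (==-refl a) (λ u ne → sym (==-false (ne ∘ sym)))) (cong suc (#-zero {n} (λ _ → refl)))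

∑-𝟙 : ∀ {k} (f : VSet k) → ∑ (𝟙 ∘ f) ≡ # f
∑-𝟙 {zero} f = refl
∑-𝟙 {suc k} f = cong (𝟙 (f zero) +_) (∑-𝟙 (f ∘ suc))

#-classes : ∀ {n k} (c : Fin n → Fin k) (X : VSet n) → # X ≡ ∑ (λ a → # (λ v → X v ∧ (c v == a)))
#-classes {zero} {k} c X = sym (trans (∑-const k 0) (ℕₚ.*-zeroʳ k))
#-classes {suc n} {k} c X = trans (cong₂ _+_ first (#-classes (c ∘ suc) (X ∘ suc))) (sym (∑-+ (λ a → 𝟙 (X zero ∧ (c zero == a))) _))
  where
  first : 𝟙 (X zero) ≡ ∑ (λ a → 𝟙 (X zero ∧ (c zero == a)))
  first = trans (sym size) (sym (∑-𝟙 (λ a → X zero ∧ (c zero == a))))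
    where
    size : # (λ a → X zero ∧ (c zero == a)) ≡ 𝟙 (X zero)
    size with X zero
    ... | true = #-single (c zero)
    ... | false = #-zero {k} (λ _ → refl)

halve : ∀ k → ∃ λ m → k ≡ 2 * m ⊎ k ≡ suc (2 * m)
halve zero = 0 , inj₁ refl
halve (suc k) with halve k
... | m , inj₁ eq = m , inj₂ (cong suc eq)
... | m , inj₂ eq = suc m , inj₁ (trans (cong suc eq) (sym (ℕₚ.*-suc 2 m)))

module _ {n : ℕ} (G : Graph n) where

  Closed : VSet n → Set
  Closed X = ∀ {u v} → X u ≡ true → adj G u v ≡ true → X v ≡ true

  record Split (X Z : VSet n) : Set where
    constructor mkSplit
    field
      Z⊆X      : ∀ v → Z v ≡ true → X v ≡ true
      inhabited : ∃ λ u → Z u ≡ true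
      proper   : ∃ λ w → X w ≡ true × Z w ≡ false
      no-edge  : ∀ u v → Z u ≡ true → X v ≡ true → Z v ≡ false → adj G u v ≡ false

  -- A property `P` crossed by no edge of `X` cuts out a separation, so an exhaustive search for
  -- separations decides the matter.
  connected-or-split : ∀ X → Connected G X ⊎ ∃ (Split X)
  connected-or-split X with anyVSet? {P = Split X} ext split?
    where
    ext : Extensional (Split X)
    ext eq (mkSplit a (u , Zu) (w , Xw , Zw) d) = mkSplit (λ v p → a v (trans (eq v) p)) (u , trans (sym (eq u)) Zu)
      (w , Xw , trans (sym (eq w)) Zw) (λ u v p q r → d u v (trans (eq u) p) q (trans (eq v) r))
    split? : ∀ Z → Dec (Split X Z)
    split? Z = map′ (λ (a , b , c , d) → mkSplit a b c d) (λ (mkSplit a b c d) → a , b , c , d)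
      (all? (λ v → (Z v Boolₚ.≟ true) →-dec (X v Boolₚ.≟ true))
       ×-dec any? (λ u → Z u Boolₚ.≟ true)
       ×-dec any? (λ w → (X w Boolₚ.≟ true) ×-dec (Z w Boolₚ.≟ false))
       ×-dec all? (λ u → all? (λ v → (Z u Boolₚ.≟ true) →-dec ((X v Boolₚ.≟ true) →-dec ((Z v Boolₚ.≟ false) →-dec (adj G u v Boolₚ.≟ false))))))
  ... | yes s = inj₂ s
  ... | no none = inj₁ connected
    where
    connected : Connected G X
    connected P {u} {w} Xu Xw Pu Pw
      with any? (λ v₁ → any? (λ v₂ → (X v₁ Boolₚ.≟ true) ×-dec (X v₂ Boolₚ.≟ true) ×-dec (P v₁ Boolₚ.≟ true)
                                      ×-dec (P v₂ Boolₚ.≟ false) ×-dec (adj G v₁ v₂ Boolₚ.≟ true)))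
    ... | yes p = p
    ... | no no-crossing = ⊥-elim (none ((λ v → X v ∧ P v) , mkSplit (λ v p → proj₁ (∧-elim p)) (u , ∧-intro Xu Pu)
            (w , Xw , cong₂ _∧_ Xw Pw) no-edge))
      where
      no-edge : ∀ v₁ v₂ → X v₁ ∧ P v₁ ≡ true → X v₂ ≡ true → X v₂ ∧ P v₂ ≡ false → adj G v₁ v₂ ≡ false
      no-edge v₁ v₂ p Xv₂ q = ¬true⇒false λ e → no-crossing (v₁ , v₂ , proj₁ (∧-elim {X v₁} p) , Xv₂ , proj₂ (∧-elim {X v₁} p)
        , trans (sym (cong (_∧ P v₂) Xv₂)) q , e)

  maximum-independent : ∀ X → ∃ λ I → (I ⊆ X × Independent G I) × (∀ K → K ⊆ X × Independent G K → # K ≤ # I)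
  maximum-independent X = largest {P = λ K → K ⊆ X × Independent G K}
    (λ eq (a , b) → (λ v p → a v (trans (eq v) p)) , (λ u v p q → b u v (trans (eq u) p) (trans (eq v) q)))
    (λ K → all? (λ v → (K v Boolₚ.≟ true) →-dec (X v Boolₚ.≟ true))
       ×-dec all? (λ u → all? (λ v → (K u Boolₚ.≟ true) →-dec ((K v Boolₚ.≟ true) →-dec (adj G u v Boolₚ.≟ false)))))
    ((λ _ → false) , (λ _ ()) , (λ _ _ ()))
    (# X) (λ K (K⊆X , _) → #-mono K⊆X)

  module Colour (claw-free : ClawFree G) (no-isolated : NoIsolatedVertices G)
    {k : ℕ} (c : Fin n → Fin k) (proper : ProperColouring G k c) where

    -- All parts keep the same number `k` of colours, so these bounds add up over components.
    Solution : VSet n → Set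
    Solution X = ∃ λ S → Odd G S × (∀ {v} → v ∈ S → X v ≡ true) × # X ≤ length S * k

    module _ (X : VSet n) (closed : Closed X) (connected : Connected G X) where

      I : VSet n
      I = proj₁ (maximum-independent X)

      I⊆X : I ⊆ X
      I⊆X = proj₁ (proj₁ (proj₂ (maximum-independent X)))

      I-independent : Independent G I
      I-independent = proj₂ (proj₁ (proj₂ (maximum-independent X)))

      I-maximum : ∀ K → K ⊆ X → Independent G K → # K ≤ # I
      I-maximum K K⊆X ind = proj₂ (proj₂ (maximum-independent X)) K (K⊆X , ind)

      dominating : ∀ v → X v ≡ true → I v ≡ false → ∃ λ i → I i ≡ true × adj G v i ≡ true
      dominating v Xv Iv with isolated? G I v
      ... | inj₂ p = p
      ... | inj₁ far = ⊥-elim (<-irrefl refl (≤-trans (≤-reflexive (sym (#-insert-∉ I Iv)))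
              (I-maximum (insert v I) (λ u p → [ (λ { refl → Xv }) , I⊆X u ]′ (insert-∈ I v u p))
                (Independent-insert G I-independent (far _)))))

      class : Fin k → VSet n
      class a v = X v ∧ (c v == a)

      class⊆X : ∀ a → class a ⊆ X
      class⊆X a v p = proj₁ (∧-elim p)

      class-colour : ∀ {a v} → class a v ≡ true → c v ≡ a
      class-colour {a} {v} p = ==-sound (proj₂ (∧-elim {X v} p))

      class-independent : ∀ a → Independent G (class a)
      class-independent a u v p q = ¬true⇒false λ e → proper u v e (trans (class-colour p) (sym (class-colour q)))

      class≤ : ∀ a → # (class a) ≤ # I
      class≤ a = I-maximum (class a) (class⊆X a) (class-independent a)

      #X≤ : ∀ {M} → (∀ a → # (class a) ≤ M) → # X ≤ M * k
      #X≤ {M} p = ≤-trans (≤-reflexive (#-classes c X)) (≤-trans (∑-mono p) (≤-reflexive (trans (∑-const k M) (ℕₚ.*-comm k M))))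

      -- If all classes but one had fewer than `2 * m` vertices, a second colour would already make
      -- up for the single excess vertex of the large class.
      from-classes : ∀ m → # I ≡ suc (2 * m) → 2 * m * k < # X → ∃₂ λ a b → b ≢ a × 2 * m < # (class a) × 2 * m ≤ # (class b)
      from-classes m size many with any? (λ a → 2 * m <? # (class a))
      ... | no small = ⊥-elim (<-irrefl refl (≤-trans many (#X≤ λ a → ℕₚ.≮⇒≥ (λ lt → small (a , lt)))))
      ... | yes (a , big-a) with any? (λ b → ¬? (b ≟ a) ×-dec (2 * m ≤? # (class b)))
      ...   | yes (b , b≢a , big-b) = a , b , b≢a , big-a , big-b
      ...   | no small with #-witness (class a)
      ...     | inj₂ empty = ⊥-elim (<-irrefl refl (≤-trans (s≤s z≤n) (≤-trans big-a (≤-reflexive empty))))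
      ...     | inj₁ (v , p) = ⊥-elim (<-irrefl refl (≤-trans (s≤s many) total))
        where
        -- The colour of a neighbour of `v` witnesses that `a` is not the only colour.
        u = proj₁ (no-isolated v)
        b₀ = c u
        b₀≢a : b₀ ≢ a
        b₀≢a eq = proper v u (proj₂ (no-isolated v)) (trans (class-colour p) (sym eq))
        -- Class `a` exceeds `2 * m` by at most one, while the others fall short; in the sum the
        -- shortfall at `b₀` balances the excess at `a`.
        pointwise : ∀ d → # (class d) + 𝟙 (b₀ == d) ≤ 2 * m + 𝟙 (a == d)
        pointwise d with a ≟ d
        ... | yes refl rewrite ==-false b₀≢a = ≤-trans (≤-reflexive (ℕₚ.+-identityʳ _))
                (≤-trans (class≤ a) (≤-reflexive (trans size (ℕₚ.+-comm 1 (2 * m)))))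
        ... | no a≢d = ≤-trans (ℕₚ.+-monoʳ-≤ (# (class d)) (𝟙≤1 (b₀ == d))) (≤-trans (≤-reflexive (ℕₚ.+-comm _ 1))
                (≤-trans (ℕₚ.≰⇒> (λ le → small (d , (a≢d ∘ sym) , le))) (ℕₚ.m≤m+n _ 0)))
        sum-single : ∀ (e : Fin k) → ∑ (λ d → 𝟙 (e == d)) ≡ 1
        sum-single e = trans (∑-𝟙 (e ==_)) (#-single e)
        total : suc (# X) ≤ suc (2 * m * k)
        total = ≤-trans (≤-reflexive (trans (ℕₚ.+-comm 1 (# X))
                  (trans (cong₂ _+_ (#-classes c X) (sym (sum-single b₀))) (sym (∑-+ (λ d → # (class d)) _)))))
                (≤-trans (∑-mono pointwise) (≤-reflexive (trans (∑-+ (λ _ → 2 * m) (λ d → 𝟙 (a == d)))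
                  (trans (cong₂ _+_ (trans (∑-const k (2 * m)) (ℕₚ.*-comm k (2 * m))) (sum-single a)) (ℕₚ.+-comm _ 1)))))

      solve-connected : Solution X
      solve-connected with halve (# I)
      ... | m , parity-I with Grow.independent⇒odd G claw-free X I connected I⊆X I-independent dominating m
                                ([ (λ eq → ≤-reflexive (sym eq)) , (λ eq → ≤-trans (n≤1+n _) (≤-reflexive (sym eq))) ]′ parity-I)
      ...   | S , o , S⊆X , long with # X ≤? 2 * m * k
      ...     | yes few = S , o , S⊆X , ≤-trans few (ℕₚ.*-monoˡ-≤ k long)
      ...     | no many with parity-I
      -- With α = 2m the `k` classes cover at most `2 * m * k` vertices.
      ...       | inj₁ even = ⊥-elim (many (#X≤ λ a → ≤-trans (class≤ a) (≤-reflexive even)))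
      ...       | inj₂ odd-I with from-classes m odd-I (ℕₚ.≰⇒> many)
      ...         | a , b , b≢a , big-a , big-b
        with TwoClasses.two-classes G claw-free no-isolated X (class a) (class b) m closed (class⊆X a) (class⊆X b)
               (class-independent a) (class-independent b) (λ v p q → b≢a (trans (sym (class-colour q)) (class-colour p)))
               (λ K K⊆X ind → ≤-trans (I-maximum K K⊆X ind) (≤-reflexive odd-I)) big-a big-b
      -- Now `S'` has at least `2 * m + 1` = α vertices, and no class is larger than α.
      ...           | S' , o' , S'⊆X , long' = S' , o' , S'⊆X ,
                        ≤-trans (#X≤ λ d → ≤-trans (class≤ d) (≤-reflexive odd-I)) (ℕₚ.*-monoˡ-≤ k long')

    -- Both sides of a separation are closed and smaller, and the odd sets found there have no edges
    -- between them.
    solve : ∀ N X → # X ≤ N → Closed X → Solution X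
    solve zero X le closed = [] , mkOdd [] (λ ()) , (λ ()) , le
    solve (suc N) X le closed with connected-or-split X
    ... | inj₁ connected = solve-connected X closed connected
    ... | inj₂ (Z , mkSplit Z⊆X (u , Zu) (w , Xw , Zw) no-edge) = join-parts (solve N Z Z≤ Z-closed) (solve N Z' Z'≤ Z'-closed)
      where
      Z' : VSet n
      Z' v = X v ∧ not (Z v)
      parts : # Z + # Z' ≤ # X
      parts = #-disjoint {f = Z} {Z'} {X} Z⊆X (λ v p → proj₁ (∧-elim p)) (λ v p q → true≢false p (not-elim (proj₂ (∧-elim {X v} q))))
      Z≤ : # Z ≤ N
      Z≤ = ≤-pred (≤-trans (≤-trans (≤-reflexive (ℕₚ.+-comm 1 (# Z)))
             (≤-trans (ℕₚ.+-monoʳ-≤ (# Z) (#-pos {f = Z'} (∧-intro Xw (not-intro Zw)))) parts)) le)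
      Z'≤ : # Z' ≤ N
      Z'≤ = ≤-pred (≤-trans (≤-trans (ℕₚ.+-monoˡ-≤ (# Z') (#-pos {f = Z} Zu)) parts) le)
      Z-closed : Closed Z
      Z-closed {v} {y} Zv vy with by-cases (Z y)
      ... | inj₁ p = p
      ... | inj₂ p = true≢false vy (no-edge v y Zv (closed (Z⊆X v Zv) vy) p)
      Z'-closed : Closed Z'
      Z'-closed {v} {y} p vy = ∧-intro (closed Xv vy) (not-intro (¬true⇒false λ Zy → true≢false (adj-sym G vy) (no-edge y v Zy Xv (not-elim (proj₂ (∧-elim {X v} p))))))
        where Xv = proj₁ (∧-elim p)
      join-parts : Solution Z → Solution Z' → Solution X
      join-parts (S , o , S⊆ , long) (S' , o' , S'⊆ , long') = S ++ S'
        , Odd-++ G o o' (λ {y} {y'} p q → let Zy = S⊆ p ; Zy' = not-elim (proj₂ (∧-elim {X y'} (S'⊆ q))) in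
            (λ { refl → true≢false Zy Zy' }) , no-edge y y' Zy (proj₁ (∧-elim (S'⊆ q))) Zy')
        , (λ p → [ (λ q → Z⊆X _ (S⊆ q)) , (λ q → proj₁ (∧-elim (S'⊆ q))) ]′ (∈-++⁻ S p))
        , ≤-trans (#-split X Z) (≤-trans (ℕₚ.+-mono-≤ (≤-trans (#-mono {f = λ v → X v ∧ Z v} (λ v p → proj₂ (∧-elim {X v} p))) long) long')
            (≤-reflexive (trans (sym (ℕₚ.*-distribʳ-+ k (length S) (length S'))) (cong (_* k) (sym (length-++ S))))))

#-all : ∀ n → # {n} (λ _ → true) ≡ n
#-all zero = refl
#-all (suc n) = cong suc (#-all n)

theorem2p2 : ∀ (n : ℕ) (G : Graph n) → NoIsolatedVertices G → ClawFree G
    → ∀ (k m : ℕ) → IsChromaticNumber G k → IsFo G m → n ≤ m * k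
theorem2p2 n G no-isolated claw-free k m ((c , proper) , _) fo
  with Colour.solve G claw-free no-isolated c proper n (λ _ → true) (≤-reflexive (#-all n)) (λ _ _ → refl)
... | S , o , _ , long = ≤-trans (≤-reflexive (sym (#-all n))) (≤-trans long (ℕₚ.*-monoˡ-≤ k (Odd⇒≤Fo G fo o)))
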